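{- Let $G$ be a multigraph (multiple edges allowed) with maximum degree $\Delta$. (a) If $\Delta\leq 3$, then all $(\Delta+1)$-edge-colourings of $G$ are Kempe equivalent. (b) If $\Delta=4$, then all $6$-edge-colourings of $G$ are Kempe equivalent.
   Context: A $k$-edge-colouring of a multigraph $G$ is an assignment of colours from $\{1,\ldots,k\}$ to the edges of $G$ such that any two distinct edges sharing an endpoint (including parallel edges) receive different colours. Given a $k$-edge-colouring and two colours $a,b$, a Kempe change is the operation of interchanging $a$ and $b$ on one connected component of the subgraph formed by the edges coloured $a$ or $b$ (a maximal alternating path or alternating cycle). Two $k$-edge-colourings are Kempe equivalent if one can be obtained from the other by a sequence of Kempe changes; colourings differing only by a permutation of colours are regarded as the same. -}

module Defs where

open import Data.Nat using (ℕ; zero; suc; _+_; _⊔_)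
open import Data.Fin using (Fin)
open import Data.Fin.Properties using (_≟_)
open import Data.Fin.Permutation using (Permutation′; _⟨$⟩ʳ_)
open import Data.List using (List; map; foldr)
open import Data.Nat.ListAction using (sum)
open import Data.List using () renaming (allFin to allFinL)
open import Data.Product using (Σ; _×_; _,_; proj₁; proj₂; ∃)
open import Data.Sum using (_⊎_)
open import Relation.Nullary using (¬_; yes; no)
open import Relation.Binary.PropositionalEquality using (_≡_; _≢_)
open import Relation.Binary.Construct.Closure.ReflexiveTransitive using (Star)

record Multigraph : Set where
  field
    n    : ℕ
    m    : ℕ
    ends : Fin m → Fin n × Fin n
    loopless : ∀ e → proj₁ (ends e) ≢ proj₂ (ends e)

module _ (G : Multigraph) where
  open Multigraph G

  Incident : Fin n → Fin m → Set
  Incident v e = (proj₁ (ends e) ≡ v) ⊎ (proj₂ (ends e) ≡ v)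

  ShareEnd : Fin m → Fin m → Set
  ShareEnd e f = Σ (Fin n) λ v → Incident v e × Incident v f

  private
    ind : Fin n → Fin n → ℕ
    ind u v with u ≟ v
    ... | yes _ = 1
    ... | no  _ = 0

  degree : Fin n → ℕ
  degree v = sum (map (λ e → ind (proj₁ (ends e)) v + ind (proj₂ (ends e)) v) (allFinL m))

  maxDegree : ℕ
  maxDegree = foldr _⊔_ 0 (map degree (allFinL n))

  EdgeColouring : ℕ → Set
  EdgeColouring k = Σ (Fin m → Fin k) λ c →
    ∀ e f → e ≢ f → ShareEnd e f → c e ≢ c f

  module _ {k : ℕ} where
    InAB : (Fin m → Fin k) → Fin k → Fin k → Fin m → Set
    InAB c a b e = (c e ≡ a) ⊎ (c e ≡ b)

    data Reach (c : Fin m → Fin k) (a b : Fin k) (e : Fin m) : Fin m → Set where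
      here : InAB c a b e → Reach c a b e e
      step : ∀ {f g} → Reach c a b e f → ShareEnd f g → InAB c a b g → Reach c a b e g

    swap : Fin k → Fin k → Fin k → Fin k
    swap a b x with x ≟ a
    ... | yes _ = b
    ... | no _ with x ≟ b
    ...   | yes _ = a
    ...   | no _  = x

    -- c' is obtained from c by one Kempe change: interchanging colours a and b
    -- on the component of the (a,b)-subgraph containing edge e₀.
    -- (Components without edges give the identity change, covered by Star's ε.)
    KempeChange : (Fin m → Fin k) → (Fin m → Fin k) → Set
    KempeChange c c' = Σ (Fin k) λ a → Σ (Fin k) λ b → Σ (Fin m) λ e₀ →
      InAB c a b e₀ ×
      (∀ f → (Reach c a b e₀ f → c' f ≡ swap a b (c f))
           × (¬ Reach c a b e₀ f → c' f ≡ c f))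

    KempeEquivalent : EdgeColouring k → EdgeColouring k → Set
    KempeEquivalent (c , _) (d , _) = Σ (Fin m → Fin k) λ c' →
      Star KempeChange c c' × Σ (Permutation′ k) λ π → ∀ e → d e ≡ π ⟨$⟩ʳ c' e

  AllKempeEquivalent : ℕ → Set
  AllKempeEquivalent k = (c d : EdgeColouring k) → KempeEquivalent c d

{-# OPTIONS --safe #-}
module Submission where

-- Let r = s + 1 bound the degrees and let k = κ + 1 ≥ 2 r − 2 be the number of colours; induct on
-- the number of edges. An edge with fewer than k neighbours in the line graph can be removed, since
-- Kempe changes of the rest extend over it. Otherwise G is simple and r-regular, and k = 2 r − 2.
-- Take an edge f = x y. Its 2 r − 2 neighbours see only k − 1 colours, so every colouring has
-- p = x a and q = y b, a ≠ b, of equal colour. The colourings with p and q equal are those of the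
-- line graph with p and q merged; there f, and then every other edge at x or y, has fewer than k
-- neighbours, and what remains is the line graph of G − {x, y} + a b. So all of them are equivalent
-- by induction, and the classes for different pairs need only be linked by common members.
-- If G − {x, y} contains a path with three edges, repeating the reduction for its outer edges
-- gives colourings lying in the class of this path and in any class at f. For r ≥ 3 the edge x y
-- can be chosen so that such a path exists, or else so that x and y have the same other
-- neighbours (as in complete graphs); then the classes of {x a, y b} and {x b, y c} have a common
-- member by a greedy extension.

open import Defs
open import Data.Empty using (⊥-elim)
open import Data.Nat using (ℕ; zero; suc; pred; _+_; _⊔_; _≤_; _<_; z≤n; s≤s; _≤?_)
import Data.Nat.Properties as ℕₚ
open import Data.Fin using (Fin; zero; suc; punchIn; punchOut)
open import Data.Fin.Properties using (_≟_; any?; punchIn-punchOut)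
open import Data.Vec.Functional using (updateAt)
open import Data.Vec.Functional.Properties using (updateAt-updates; updateAt-minimal)
open import Data.Fin.Permutation using () renaming (id to idPermutation)
open import Data.List using (List; []; _∷_; _++_; map; foldr; filter; length; allFin)
open import Data.Nat.ListAction using (sum)
open import Data.List.Properties using (length-++; length-map; length-tabulate)
open import Data.List.Relation.Unary.Any using (here; there)
import Data.List.Relation.Unary.All as All
open import Data.List.Relation.Unary.AllPairs using ([]; _∷_)
open import Data.List.Relation.Unary.Unique.Propositional using (Unique)
open import Data.List.Relation.Unary.Unique.Propositional.Properties using (allFin⁺; filter⁺)
open import Data.List.Membership.Propositional using (_∈_; _∉_)
open import Data.List.Membership.Propositional.Properties
  using (∈-filter⁺; ∈-filter⁻; ∈-map⁺; ∈-allFin; ∈-++⁺ˡ; ∈-++⁺ʳ)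
open import Data.List.Membership.DecPropositional using (_∈?_)
open import Data.Unit using (⊤; tt)
open import Data.Product using (Σ; Σ-syntax; ∃; _×_; _,_; proj₁; proj₂)
open import Data.Sum using (_⊎_; inj₁; inj₂; [_,_]′)
open import Function using (_∘_; id)
open import Relation.Nullary using (¬_; Dec; yes; no)
open import Relation.Nullary.Decidable using (_×-dec_; _⊎-dec_; ¬?; decidable-stable; toWitness)
open import Relation.Binary.PropositionalEquality
  using (_≡_; _≢_; refl; sym; trans; cong; subst; ≢-sym)
open import Relation.Binary.Construct.Closure.ReflexiveTransitive using (Star; ε; _◅_; _◅◅_; gmap)

-- Counting with covering lists

∈-delete : {A : Set} {x : A} {xs : List A} → x ∈ xs →
  ∃ λ ys → suc (length ys) ≡ length xs × (∀ {z} → z ≢ x → z ∈ xs → z ∈ ys)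
∈-delete {xs = y ∷ ys} (here refl) = ys , refl ,
  λ { z≢x (here z≡x) → ⊥-elim (z≢x z≡x) ; _ (there z∈) → z∈ }
∈-delete {xs = y ∷ _} (there x∈) with ∈-delete x∈
... | ys , len , keep = y ∷ ys , cong suc len ,
  λ { _ (here eq) → here eq ; z≢x (there z∈) → there (keep z≢x z∈) }

-- Each entry of `xs` uses up one position of `ys`, and uniqueness ensures that the later entries
-- survive its deletion.
unique-length : {A : Set} {xs ys : List A} → Unique xs → (∀ {z} → z ∈ xs → z ∈ ys) → length xs ≤ length ys
unique-length [] _ = z≤n
unique-length (x∉ ∷ uniq) sub with ∈-delete (sub (here refl))
... | _ , len , keep = subst (_ ≤_) len
  (s≤s (unique-length uniq λ z∈ → keep (≢-sym (All.lookup x∉ z∈)) (sub (there z∈))))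

fresh : ∀ {k} (xs : List (Fin k)) → length xs < k → ∃ λ z → z ∉ xs
fresh {k} xs len with any? (λ z → ¬? (_∈?_ _≟_ z xs))
... | yes found = found
... | no none = ⊥-elim (ℕₚ.<⇒≱ len (subst (_≤ length xs) (length-tabulate {n = k} id)
  (unique-length (allFin⁺ k) λ {z} _ → decidable-stable (_∈?_ _≟_ z xs) λ z∉ → none (z , z∉))))

-- A bound on the cardinality of `P`. The list may have repetitions and entries outside `P`, so
-- bounds pass to subsets, unions and images by plain list operations.
Covered : {A : Set} → (A → Set) → ℕ → Set
Covered P n = ∃ λ xs → length xs ≤ n × (∀ {x} → P x → x ∈ xs)

module _ {A : Set} {P : A → Set} where

  covered-⊆ : {Q : A → Set} {n : ℕ} → (∀ {x} → Q x → P x) → Covered P n → Covered Q n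
  covered-⊆ sub (xs , len , cov) = xs , len , cov ∘ sub

  covered-≤ : {i j : ℕ} → i ≤ j → Covered P i → Covered P j
  covered-≤ i≤j (xs , len , cov) = xs , ℕₚ.≤-trans len i≤j , cov

  covered-⊎ : {Q : A → Set} {i j : ℕ} → Covered P i → Covered Q j → Covered (λ x → P x ⊎ Q x) (i + j)
  covered-⊎ (xs , lenx , covx) (ys , leny , covy) = xs ++ ys ,
    subst (_≤ _) (sym (length-++ xs)) (ℕₚ.+-mono-≤ lenx leny) ,
    [ ∈-++⁺ˡ ∘ covx , ∈-++⁺ʳ xs ∘ covy ]′

  covered-map : {B : Set} {Q : B → Set} {n : ℕ} (f : A → B) →
    (∀ {y} → Q y → ∃ λ x → P x × f x ≡ y) → Covered P n → Covered Q n
  covered-map f onto (xs , len , cov) = map f xs , subst (_≤ _) (sym (length-map f xs)) len ,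
    λ q → let x , p , fx≡y = onto q in subst (_∈ _) fx≡y (∈-map⁺ f (cov p))

  covered-delete : {n : ℕ} {x : A} → P x → Covered P n → Covered (λ z → P z × z ≢ x) (pred n)
  covered-delete p (xs , len , cov) with ∈-delete (cov p)
  ... | ys , leny , keep = ys , ℕₚ.pred-mono-≤ (subst (_≤ _) (sym leny) len) ,
    λ (pz , z≢x) → keep z≢x (cov pz)

  covered-zero : {x : A} → P x → ¬ Covered P 0
  covered-zero p ([] , _ , cov) with () ← cov p

covered-all : ∀ {m} {P : Fin m → Set} → Covered P m
covered-all {m} = allFin m , ℕₚ.≤-reflexive (length-tabulate {n = m} id) , λ {x} _ → ∈-allFin x

-- The filtered list is without repetitions and lies in `P`, so every cover is at least as long and
-- its length decides.
covered? : ∀ {m} {P : Fin m → Set} → (∀ x → Dec (P x)) → (n : ℕ) → Dec (Covered P n)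
covered? {m} P? n with length (filter P? (allFin m)) ≤? n
... | yes short = yes (_ , short , λ {x} p → ∈-filter⁺ P? (∈-allFin x) p)
... | no long = no λ (xs , len , cov) → long (ℕₚ.≤-trans
  (unique-length (filter⁺ P? (allFin⁺ m)) λ z∈ → cov (proj₂ (∈-filter⁻ P? {xs = allFin m} z∈))) len)

escape : ∀ {m n} {P : Fin m → Set} → (∀ x → Dec (P x)) → ¬ Covered P n →
  (xs : List (Fin m)) → length xs ≤ n → ∃ λ x → P x × x ∉ xs
escape P? rich xs len with any? (λ x → P? x ×-dec ¬? (_∈?_ _≟_ x xs))
... | yes found = found
... | no none = ⊥-elim (rich (xs , len , λ {x} p →
  decidable-stable (_∈?_ _≟_ x xs) λ x∉ → none (x , p , x∉)))

length-filter≤sum : {A : Set} {P : A → Set} (P? : ∀ x → Dec (P x)) (f : A → ℕ) →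
  (∀ {x} → P x → 1 ≤ f x) → ∀ xs → length (filter P? xs) ≤ sum (map f xs)
length-filter≤sum P? f positive [] = z≤n
length-filter≤sum P? f positive (x ∷ xs) with P? x
... | yes p = ℕₚ.+-mono-≤ (positive p) (length-filter≤sum P? f positive xs)
... | no _ = ℕₚ.≤-trans (length-filter≤sum P? f positive xs) (ℕₚ.m≤n+m _ (f x))

-- Recolouring of graphs

-- Vertices form a decidable subset of a fixed `Fin m`: deletion changes only `V`, and a colouring
-- stays one function on `Fin m`, constrained on `V` alone.
record Graph (m : ℕ) : Set₁ where
  field
    V     : Fin m → Set
    V?    : ∀ u → Dec (V u)
    E     : Fin m → Fin m → Set
    E?    : ∀ u v → Dec (E u v)
    E-sym : ∀ {u v} → E u v → E v u
    E-irr : ∀ {u} → ¬ E u u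

open Graph

restrict : ∀ {m} (H : Graph m) (P : Fin m → Set) → (∀ u → Dec (P u)) → Graph m
restrict H P P? = record
  { V = λ u → V H u × P u ; V? = λ u → V? H u ×-dec P? u
  ; E = E H ; E? = E? H ; E-sym = E-sym H ; E-irr = E-irr H }

_─_ : ∀ {m} → Graph m → Fin m → Graph m
H ─ v = restrict H (_≢ v) λ u → ¬? (u ≟ v)

module Recolouring {m κ : ℕ} where

  Colour : Set
  Colour = Fin (suc κ)

  Proper : Graph m → (Fin m → Colour) → Set
  Proper H c = ∀ {u v} → V H u → V H v → E H u v → c u ≢ c v

  Colouring : Graph m → Set
  Colouring H = Σ (Fin m → Colour) (Proper H)

  data Flip (a b x y : Colour) : Set where
    keep : y ≡ x → Flip a b x y
    fwd  : x ≡ a → y ≡ b → Flip a b x y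
    bwd  : x ≡ b → y ≡ a → Flip a b x y

  Flip-comm : ∀ {a b x y} → Flip a b x y → Flip b a x y
  Flip-comm (keep eq) = keep eq
  Flip-comm (fwd p q) = bwd p q
  Flip-comm (bwd p q) = fwd p q

  -- Since both colourings are proper, the set of recoloured vertices is automatically a union of
  -- Kempe components.
  Step : (H : Graph m) → Colouring H → Colouring H → Set
  Step H (c , _) (d , _) = Σ Colour λ a → Σ Colour λ b → ∀ {u} → V H u → Flip a b (c u) (d u)

  _⊢_≈_ : (H : Graph m) → Colouring H → Colouring H → Set
  H ⊢ c ≈ d = Star (Step H) c d

  AllEq : Graph m → Set
  AllEq H = (c d : Colouring H) → H ⊢ c ≈ d

  Agree : Graph m → (c d : Fin m → Colour) → Set
  Agree H c d = ∀ {u} → V H u → c u ≡ d u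

  agree-≈ : ∀ H (c d : Colouring H) → Agree H (proj₁ d) (proj₁ c) → H ⊢ c ≈ d
  -- The two may still differ as functions off `V H`; a step that keeps every colour joins them, so
  -- its colour pair is arbitrary.
  agree-≈ H c d eq = (zero , zero , keep ∘ eq) ◅ ε

  -- What the induction carries from `H′` to the larger `H`: `allEq` transfers equivalence, and
  -- `extend` builds colourings of `H` with prescribed values on `H′`, later the common members of
  -- two classes.
  record _⇝_ (H H′ : Graph m) : Set where
    field
      sub    : ∀ {u} → V H′ u → V H u
      extend : (c : Colouring H′) → Σ[ d ∈ Colouring H ] Agree H′ (proj₁ d) (proj₁ c)
      allEq  : AllEq H′ → AllEq H

  open _⇝_

  ⇝-trans : ∀ {H H′ H″} → H ⇝ H′ → H′ ⇝ H″ → H ⇝ H″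
  ⇝-trans r s = record
    { sub = sub r ∘ sub s
    ; extend = λ c → let c₁ , eq₁ = extend s c ; c₂ , eq₂ = extend r c₁ in
        c₂ , λ v → trans (eq₂ (sub s v)) (eq₁ v)
    ; allEq = allEq r ∘ allEq s }

  ⇝-iso : ∀ {H H′} → (∀ {u} → V H u → V H′ u) → (∀ {u} → V H′ u → V H u) →
    (∀ {u v} → V H u → V H v → E H u v → E H′ u v) →
    (∀ {u v} → V H u → V H v → E H′ u v → E H u v) → H ⇝ H′
  ⇝-iso {H} {H′} to from toE fromE = record
    { sub = from
    ; extend = λ c → back c , λ _ → refl
    ; allEq = λ all c d → gmap back (λ {x} {y} → back-step {x} {y}) (all (forth c) (forth d)) }
    where
    forth : Colouring H → Colouring H′
    forth (c , pr) = c , λ u v e → pr (from u) (from v) (fromE (from u) (from v) e)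
    back : Colouring H′ → Colouring H
    back (c , pr) = c , λ u v e → pr (to u) (to v) (toE u v e)
    back-step : ∀ {c d} → Step H′ c d → Step H (back c) (back d)
    back-step (a , b , fl) = a , b , λ u∈ → fl (to u∈)

  free-colour : (c : Fin m → Colour) {N : Fin m → Set} → Covered N κ →
    ∃ λ z → ∀ {u} → N u → c u ≢ z
  free-colour c (xs , len , cov) with fresh (map c xs) (s≤s (subst (_≤ κ) (sym (length-map c xs)) len))
  ... | z , z∉ = z , λ { n refl → z∉ (∈-map⁺ c (cov n)) }

  -- Leaving out `v` makes room for forbidding `a`, so at most `κ` of the `κ + 1` colours are
  -- excluded. This serves when another vertex of `N` repeats the colour of `v`.
  spare-colour : (c : Fin m → Colour) (a : Colour) {N : Fin m → Set} {v : Fin m} → N v → Covered N κ →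
    ∃ λ z → z ≢ a × (∀ {u} → N u × u ≢ v → c u ≢ z)
  spare-colour c a nv (xs , len , cov) with ∈-delete (cov nv)
  ... | ys , leny , rest
    with fresh (a ∷ map c ys)
           (s≤s (ℕₚ.≤-trans (ℕₚ.≤-reflexive (trans (cong suc (length-map c ys)) leny)) len))
  ... | z , z∉ = z , (λ { refl → z∉ (here refl) }) ,
    λ { (n , u≢v) refl → z∉ (there (∈-map⁺ c (rest u≢v (cov n)))) }

  -- Deleting a vertex with at most κ neighbours

  module Remove (H : Graph m) {v : Fin m} (v∈ : V H v)
                (short : Covered (λ u → V H u × E H v u) κ) where

    Free : (Fin m → Colour) → Colour → Set
    Free c z = ∀ {u} → V H u → E H v u → c u ≢ z

    put : (c : Colouring (H ─ v)) (z : Colour) → Free (proj₁ c) z → Colouring H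
    put (c , pr) z free = updateAt c v (λ _ → z) , proper
      where
      proper : Proper H (updateAt c v (λ _ → z))
      proper {u} {w} u∈ w∈ e with u ≟ v | w ≟ v
      ... | yes refl | yes refl = ⊥-elim (E-irr H e)
      ... | yes refl | no w≢v
        rewrite updateAt-updates v {λ _ → z} c | updateAt-minimal w v {λ _ → z} c w≢v =
          ≢-sym (free w∈ e)
      ... | no u≢v | yes refl
        rewrite updateAt-updates v {λ _ → z} c | updateAt-minimal u v {λ _ → z} c u≢v =
          free u∈ (E-sym H e)
      ... | no u≢v | no w≢v
        rewrite updateAt-minimal u v {λ _ → z} c u≢v | updateAt-minimal w v {λ _ → z} c w≢v =
          pr (u∈ , u≢v) (w∈ , w≢v) e

    put-agree : ∀ c z (free : Free (proj₁ c) z) → Agree (H ─ v) (proj₁ (put c z free)) (proj₁ c)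
    put-agree (c , _) z _ {u} (_ , u≢v) = updateAt-minimal u v c u≢v

    put-at : ∀ c z (free : Free (proj₁ c) z) → proj₁ (put c z free) v ≡ z
    put-at (c , _) z _ = updateAt-updates v c

    drop : Colouring H → Colouring (H ─ v)
    drop (c , pr) = c , λ (u∈ , _) (w∈ , _) → pr u∈ w∈

    Lift : Colouring H → Colouring (H ─ v) → Set
    Lift c c₁ = Σ[ d ∈ Colouring H ] H ⊢ c ≈ d × Agree (H ─ v) (proj₁ d) (proj₁ c₁)

    Flips : Colour → Colour → Colouring H → Colouring (H ─ v) → Set
    Flips a b (c , _) (c₁ , _) = ∀ {u} → V H u → u ≢ v → Flip a b (c u) (c₁ u)

    put-step : ∀ {a b} c c₁ z (free : Free (proj₁ c₁) z) → Flips a b c c₁ → Flip a b (proj₁ c v) z → Lift c c₁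
    put-step {a} {b} c c₁ z free fl flv = put c₁ z free , (a , b , flips) ◅ ε , put-agree c₁ z free
      where
      flips : ∀ {u} → V H u → Flip a b (proj₁ c u) (proj₁ (put c₁ z free) u)
      flips {u} u∈ with u ≟ v
      ... | yes refl = subst (Flip a b _) (sym (put-at c₁ z free)) flv
      ... | no u≢v = subst (Flip a b _) (sym (put-agree c₁ z free (u∈ , u≢v))) (fl u∈ u≢v)

    -- The colour of `v` can stay: a neighbour now has its old colour, which differs by properness,
    -- or else `a` or `b`.
    lift-unaffected : ∀ {a b} (c : Colouring H) c₁ → Flips a b c c₁ →
      proj₁ c v ≢ a → proj₁ c v ≢ b → Lift c c₁
    lift-unaffected c@(c′ , pr) c₁ fl ≢a ≢b = put-step c c₁ (c′ v) free fl (keep refl)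
      where
      free : Free (proj₁ c₁) (c′ v)
      free {u} u∈ e eq with fl u∈ (λ { refl → E-irr H e })
      ... | keep p  = pr v∈ u∈ e (trans (sym eq) p)
      ... | fwd _ p = ≢b (trans (sym eq) p)
      ... | bwd _ p = ≢a (trans (sym eq) p)

    -- Keep `a` at `v` if no neighbour now has it, else move to `b` if that is free. If both are
    -- blocked, two neighbours had colour `b` before, and `detour` applies.
    lift-affected : ∀ {a b} (c : Colouring H) c₁ → Flips a b c c₁ → proj₁ c v ≡ a → Lift c c₁
    lift-affected {a} {b} c@(c′ , pr) c₁@(c₁′ , _) fl cv≡a = go (blocked a) (blocked b)
      where
      Blocked : Colour → Set
      Blocked z = ∃ λ u → (V H u × E H v u) × c₁′ u ≡ z
      blocked : ∀ z → Dec (Blocked z)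
      blocked z = any? λ u → (V? H u ×-dec E? H v u) ×-dec (c₁′ u ≟ z)
      nbr-flip : ∀ {u} → V H u → E H v u → Flip a b (c′ u) (c₁′ u)
      nbr-flip u∈ e = fl u∈ λ { refl → E-irr H e }
      -- No neighbour had `a`, the colour of `v`; so one that now has `a` or `b` came from `b`.
      was-b : ∀ {u} → V H u → E H v u → c₁′ u ≡ a ⊎ c₁′ u ≡ b → c′ u ≡ b
      was-b {u} u∈ e now with nbr-flip u∈ e
      ... | fwd p _ = ⊥-elim (pr v∈ u∈ e (trans cv≡a (sym p)))
      ... | bwd p _ = p
      ... | keep p with now
      ...   | inj₁ q = ⊥-elim (pr v∈ u∈ e (trans cv≡a (trans (sym q) p)))
      ...   | inj₂ q = trans (sym p) q

      -- Two neighbours share a colour, so a third colour is available at v.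
      detour : Blocked a → Blocked b → Lift c c₁
      detour (u₁ , (u₁∈ , e₁) , eq₁) (u₂ , (u₂∈ , e₂) , eq₂) = d , (recolour ◅ c₂≈d) , agree
        where
        b₁ : c′ u₁ ≡ b
        b₁ = was-b u₁∈ e₁ (inj₁ eq₁)
        b₂ : c′ u₂ ≡ b
        b₂ = was-b u₂∈ e₂ (inj₂ eq₂)
        u₂≢u₁ : u₂ ≢ u₁
        u₂≢u₁ refl = pr v∈ u₁∈ e₁ (trans cv≡a (trans (sym eq₁) (trans eq₂ (sym b₁))))
        spare : ∃ λ z → z ≢ a × (∀ {u} → (V H u × E H v u) × u ≢ u₁ → c′ u ≢ z)
        spare = spare-colour c′ a (u₁∈ , e₁) short
        z = proj₁ spare
        avoid : ∀ {u} → V H u → E H v u → u ≢ u₁ → c′ u ≢ z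
        avoid u∈ e u≢ = proj₂ (proj₂ spare) ((u∈ , e) , u≢)
        free : Free c′ z
        free {u} u∈ e with u ≟ u₁
        ... | no u≢ = avoid u∈ e u≢
        ... | yes refl = λ eq → avoid u₂∈ e₂ u₂≢u₁ (trans b₂ (trans (sym b₁) eq))
        c₂ : Colouring H
        c₂ = put (drop c) z free
        at : proj₁ c₂ v ≡ z
        at = put-at (drop c) z free
        off : ∀ {u} → V H u → u ≢ v → proj₁ c₂ u ≡ c′ u
        off u∈ u≢ = put-agree (drop c) z free (u∈ , u≢)
        recolour : Step H c c₂
        recolour = a , z , flips
          where
          flips : ∀ {u} → V H u → Flip a z (c′ u) (proj₁ c₂ u)
          flips {u} u∈ with u ≟ v
          ... | yes refl = fwd cv≡a at
          ... | no u≢ = keep (off u∈ u≢)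
        lifted : Lift c₂ c₁
        lifted = lift-unaffected c₂ c₁
          (λ {u} u∈ u≢ → subst (λ x → Flip a b x (c₁′ u)) (sym (off u∈ u≢)) (fl u∈ u≢))
          (λ eq → proj₁ (proj₂ spare) (trans (sym at) eq))
          (λ eq → avoid u₂∈ e₂ u₂≢u₁ (trans b₂ (trans (sym eq) at)))
        d = proj₁ lifted
        c₂≈d = proj₁ (proj₂ lifted)
        agree = proj₂ (proj₂ lifted)

      go : Dec (Blocked a) → Dec (Blocked b) → Lift c c₁
      go (no free) _ = put-step c c₁ a (λ u∈ e eq → free (_ , (u∈ , e) , eq)) fl (keep (sym cv≡a))
      go (yes _) (no free) = put-step c c₁ b (λ u∈ e eq → free (_ , (u∈ , e) , eq)) fl (fwd cv≡a refl)
      go (yes ba) (yes bb) = detour ba bb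

    lift-step : ∀ {a b} (c : Colouring H) c₁ → Flips a b c c₁ → Lift c c₁
    lift-step {a} {b} c c₁ fl with proj₁ c v ≟ a | proj₁ c v ≟ b
    ... | yes eq | _ = lift-affected c c₁ fl eq
    ... | no _ | yes eq = lift-affected c c₁ (λ u∈ u≢ → Flip-comm (fl u∈ u≢)) eq
    ... | no ≢a | no ≢b = lift-unaffected c c₁ fl ≢a ≢b

    -- Agreement is required off `v` only, so each step can continue from whatever colour the
    -- previous one left at `v`.
    lift-path : ∀ {c₁ d₁} → (H ─ v) ⊢ c₁ ≈ d₁ → (c : Colouring H) →
      Agree (H ─ v) (proj₁ c) (proj₁ c₁) → Lift c d₁
    lift-path ε c eq = c , ε , eq
    lift-path (_◅_ {j = c₂} (a , b , fl) path) c eq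
      with lift-step c c₂ (λ {u} u∈ u≢ →
             subst (λ x → Flip a b x (proj₁ c₂ u)) (sym (eq (u∈ , u≢))) (fl (u∈ , u≢)))
    ... | c′ , c≈c′ , eq′ with lift-path path c′ eq′
    ... | d , c′≈d , eq″ = d , c≈c′ ◅◅ c′≈d , eq″

    remove : H ⇝ (H ─ v)
    remove = record { sub = proj₁ ; extend = ext ; allEq = all }
      where
      ext : (c : Colouring (H ─ v)) → Σ[ d ∈ Colouring H ] Agree (H ─ v) (proj₁ d) (proj₁ c)
      ext c = let z , free = free-colour (proj₁ c) short in
        put c z (λ u∈ e → free (u∈ , e)) , put-agree c z (λ u∈ e → free (u∈ , e))
      all : AllEq (H ─ v) → AllEq H
      all eqv c d with lift-path (eqv (drop c) (drop d)) c (λ _ → refl)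
      -- `c′` and `d` differ at most at `v`; one step with their two colours at `v` joins them.
      ... | c′ , c≈c′ , eq = c≈c′ ◅◅ ((proj₁ c′ v , proj₁ d v , flips) ◅ ε)
        where
        flips : ∀ {u} → V H u → Flip (proj₁ c′ v) (proj₁ d v) (proj₁ c′ u) (proj₁ d u)
        flips {u} u∈ with u ≟ v
        ... | yes refl = fwd refl refl
        ... | no u≢ = keep (sym (eq (u∈ , u≢)))

  open Remove using (remove) public

  -- The vertices outside `P` go one at a time. Deletions only lower degrees, so the bound taken in
  -- `H` stays valid throughout.
  prune : (H : Graph m) {P : Fin m → Set} (P? : ∀ u → Dec (P u)) →
    (∀ {v} → V H v → ¬ P v → Covered (λ u → V H u × E H v u) κ) → H ⇝ restrict H P P?
  prune H {P} P? short = ⇝-trans (along (allFin m))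
    (⇝-iso (λ { (u∈ , inj₁ p) → u∈ , p ; {u} (_ , inj₂ u∉) → ⊥-elim (u∉ (∈-allFin u)) })
           (λ (u∈ , p) → u∈ , inj₁ p) (λ _ _ → id) (λ _ _ → id))
    where
    Kept : List (Fin m) → Graph m
    Kept vs = restrict H (λ u → P u ⊎ u ∉ vs) λ u → P? u ⊎-dec ¬? (_∈?_ _≟_ u vs)
    same : ∀ v vs → ¬ V H v ⊎ P v → Kept vs ⇝ Kept (v ∷ vs)
    same v vs useless = ⇝-iso to (λ { (u∈ , inj₁ p) → u∈ , inj₁ p ; (u∈ , inj₂ u∉) → u∈ , inj₂ (u∉ ∘ there) })
      (λ _ _ → id) (λ _ _ → id)
      where
      to : ∀ {u} → V (Kept vs) u → V (Kept (v ∷ vs)) u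
      to (u∈ , inj₁ p) = u∈ , inj₁ p
      to {u} (u∈ , inj₂ u∉) with u ≟ v
      ... | no u≢ = u∈ , inj₂ λ { (here eq) → u≢ eq ; (there i) → u∉ i }
      ... | yes refl = [ (λ v∉ → ⊥-elim (v∉ u∈)) , (λ p → u∈ , inj₁ p) ]′ useless
    next : ∀ v vs → Kept vs ⇝ Kept (v ∷ vs)
    next v vs with V? H v | P? v
    ... | no v∉ | _ = same v vs (inj₁ v∉)
    ... | yes _ | yes p = same v vs (inj₂ p)
    ... | yes v∈ | no ¬p with _∈?_ _≟_ v vs
    ...   | yes v∈vs = ⇝-iso
      (λ { (u∈ , inj₁ p) → u∈ , inj₁ p
         ; (u∈ , inj₂ u∉) → u∈ , inj₂ λ { (here refl) → u∉ v∈vs ; (there i) → u∉ i } })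
      (λ { (u∈ , inj₁ p) → u∈ , inj₁ p ; (u∈ , inj₂ u∉) → u∈ , inj₂ (u∉ ∘ there) })
      (λ _ _ → id) (λ _ _ → id)
    ...   | no v∉vs = ⇝-trans
      (remove (Kept vs) (v∈ , inj₂ v∉vs) (covered-⊆ (λ ((u∈ , _) , e) → u∈ , e) (short v∈ ¬p)))
      (⇝-iso
        (λ { ((u∈ , inj₁ p) , _) → u∈ , inj₁ p
           ; ((u∈ , inj₂ u∉) , u≢) → u∈ , inj₂ λ { (here eq) → u≢ eq ; (there i) → u∉ i } })
        (λ { (u∈ , inj₁ p) → (u∈ , inj₁ p) , λ { refl → ¬p p }
           ; (u∈ , inj₂ u∉) → (u∈ , inj₂ (u∉ ∘ there)) , λ eq → u∉ (here eq) })
        (λ _ _ → id) (λ _ _ → id))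
    along : ∀ vs → H ⇝ Kept vs
    along [] = ⇝-iso (λ u∈ → u∈ , inj₂ λ ()) proj₁ (λ _ _ → id) (λ _ _ → id)
    along (v ∷ vs) = ⇝-trans (along vs) (next v vs)

  -- Identifying two non-adjacent vertices

  module Merge (H : Graph m) {p q : Fin m} (p∈ : V H p) (q∈ : V H q) (p≢q : p ≢ q) (¬qp : ¬ E H q p) where

    -- The quotient of `H` by identifying `q` with `p`. Its colourings correspond to those of `H`
    -- with equal colours at `p` and `q`, through `split` and `fuse`.
    merged : Graph m
    merged = record
      { V = λ u → V H u × u ≢ q
      ; V? = λ u → V? H u ×-dec ¬? (u ≟ q)
      ; E = λ u w → E H u w ⊎ (u ≡ p × E H q w ⊎ w ≡ p × E H q u)
      ; E? = λ u w → E? H u w ⊎-dec (((u ≟ p) ×-dec E? H q w) ⊎-dec ((w ≟ p) ×-dec E? H q u))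
      ; E-sym = λ { (inj₁ e) → inj₁ (E-sym H e) ; (inj₂ (inj₁ x)) → inj₂ (inj₂ x)
                  ; (inj₂ (inj₂ x)) → inj₂ (inj₁ x) }
      ; E-irr = λ { (inj₁ e) → E-irr H e ; (inj₂ (inj₁ (refl , e))) → ¬qp e
                  ; (inj₂ (inj₂ (refl , e))) → ¬qp e } }

    module _ (c : Fin m → Colour) where
      splitColour : Fin m → Colour
      splitColour = updateAt c q (λ _ → c p)

      split-q : splitColour q ≡ c p
      split-q = updateAt-updates q c

      split-off : ∀ {u} → u ≢ q → splitColour u ≡ c u
      split-off {u} = updateAt-minimal u q c

    split : Colouring merged → Colouring H
    split (c , pr) = splitColour c , proper
      where
      proper : Proper H (splitColour c)
      proper {u} {w} u∈ w∈ e eq with u ≟ q | w ≟ q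
      ... | yes refl | yes refl = E-irr H e
      ... | yes refl | no w≢ = pr (p∈ , p≢q) (w∈ , w≢) (inj₂ (inj₁ (refl , e)))
        (trans (sym (split-q c)) (trans eq (split-off c w≢)))
      ... | no u≢ | yes refl = pr (p∈ , p≢q) (u∈ , u≢) (inj₂ (inj₁ (refl , E-sym H e)))
        (trans (sym (split-q c)) (trans (sym eq) (split-off c u≢)))
      ... | no u≢ | no w≢ = pr (u∈ , u≢) (w∈ , w≢) (inj₁ e)
        (trans (sym (split-off c u≢)) (trans eq (split-off c w≢)))

    split-equal : (c : Colouring merged) → proj₁ (split c) p ≡ proj₁ (split c) q
    split-equal (c , _) = trans (split-off c p≢q) (sym (split-q c))

    fuse : (c : Colouring H) → proj₁ c p ≡ proj₁ c q → Colouring merged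
    fuse (c , pr) eq = c , λ
      { (u∈ , _) (w∈ , _) (inj₁ e) → pr u∈ w∈ e
      ; _ (w∈ , _) (inj₂ (inj₁ (refl , e))) eq′ → pr q∈ w∈ e (trans (sym eq) eq′)
      ; (u∈ , _) _ (inj₂ (inj₂ (refl , e))) eq′ → pr q∈ u∈ e (trans (sym eq) (sym eq′)) }

    split-fuse : (c : Colouring H) (eq : proj₁ c p ≡ proj₁ c q) →
      ∀ u → proj₁ (split (fuse c eq)) u ≡ proj₁ c u
    split-fuse (c , _) eq u with u ≟ q
    ... | yes refl = trans (split-q c) eq
    ... | no u≢ = split-off c u≢

    split-step : ∀ {c d} → Step merged c d → Step H (split c) (split d)
    split-step {c , _} {d , _} (a , b , fl) = a , b , flips
      where
      flips : ∀ {u} → V H u → Flip a b (splitColour c u) (splitColour d u)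
      flips {u} u∈ with u ≟ q
      ... | no u≢ rewrite split-off c u≢ | split-off d u≢ = fl (u∈ , u≢)
      ... | yes refl rewrite split-q c | split-q d = fl (p∈ , p≢q)

    merge-equal : AllEq merged → (c d : Colouring H) →
      proj₁ c p ≡ proj₁ c q → proj₁ d p ≡ proj₁ d q → H ⊢ c ≈ d
    merge-equal all c d ceq deq =
      -- `split` after `fuse` restores a colouring only pointwise, hence a trivial step at either
      -- end.
      agree-≈ H c (split (fuse c ceq)) (λ {u} _ → split-fuse c ceq u)
      ◅◅ gmap split (λ {x} {y} → split-step {x} {y}) (all (fuse c ceq) (fuse d deq))
      ◅◅ agree-≈ H (split (fuse d deq)) d (λ {u} _ → sym (split-fuse d deq u))

-- Multigraphs with deletions and rerouted edges

At : ∀ {n} → Fin n → Fin n × Fin n → Set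
At v (u , w) = u ≡ v ⊎ w ≡ v

-- Deletion shrinks `Act` and rerouting changes `ends`, so all multigraphs of the induction share
-- their edge indices and all line graphs live on `Fin m`.
record Multi (n m : ℕ) : Set₁ where
  field
    ends   : Fin m → Fin n × Fin n
    Act    : Fin m → Set
    Act?   : ∀ e → Dec (Act e)
    noLoop : ∀ {e} → Act e → proj₁ (ends e) ≢ proj₂ (ends e)

  Inc : Fin n → Fin m → Set
  Inc v e = At v (ends e)

  Inc? : ∀ v e → Dec (Inc v e)
  Inc? v e = (proj₁ (ends e) ≟ v) ⊎-dec (proj₂ (ends e) ≟ v)

  Joins : Fin m → Fin n → Fin n → Set
  Joins e u v = (proj₁ (ends e) ≡ u × proj₂ (ends e) ≡ v) ⊎ (proj₁ (ends e) ≡ v × proj₂ (ends e) ≡ u)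

  Joins? : ∀ e u v → Dec (Joins e u v)
  Joins? e u v = ((proj₁ (ends e) ≟ u) ×-dec (proj₂ (ends e) ≟ v))
           ⊎-dec ((proj₁ (ends e) ≟ v) ×-dec (proj₂ (ends e) ≟ u))

  Joins-sym : ∀ {e u v} → Joins e u v → Joins e v u
  Joins-sym (inj₁ j) = inj₂ j
  Joins-sym (inj₂ j) = inj₁ j

  incˡ : ∀ {e u v} → Joins e u v → Inc u e
  incˡ (inj₁ (eq , _)) = inj₁ eq
  incˡ (inj₂ (_ , eq)) = inj₂ eq

  incʳ : ∀ {e u v} → Joins e u v → Inc v e
  incʳ = incˡ ∘ Joins-sym

  which-end : ∀ {e u v w} → Joins e u v → Inc w e → w ≡ u ⊎ w ≡ v
  which-end (inj₁ (refl , refl)) (inj₁ refl) = inj₁ refl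
  which-end (inj₁ (refl , refl)) (inj₂ refl) = inj₂ refl
  which-end (inj₂ (refl , refl)) (inj₁ refl) = inj₂ refl
  which-end (inj₂ (refl , refl)) (inj₂ refl) = inj₁ refl

  other-end : ∀ {e u} → Inc u e → ∃ λ v → Joins e u v
  other-end (inj₁ eq) = _ , inj₁ (eq , refl)
  other-end (inj₂ eq) = _ , inj₂ (refl , eq)

  joins-≢ : ∀ {e u v} → Act e → Joins e u v → u ≢ v
  joins-≢ e∈ (inj₁ (refl , refl)) = noLoop e∈
  joins-≢ e∈ (inj₂ (refl , refl)) = ≢-sym (noLoop e∈)

  line : Graph m
  line = record
    { V = Act
    ; V? = Act?
    ; E = λ e f → e ≢ f × ∃ λ v → Inc v e × Inc v f
    ; E? = λ e f → ¬? (e ≟ f) ×-dec any? λ v → Inc? v e ×-dec Inc? v f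
    ; E-sym = λ (e≢f , v , i , j) → ≢-sym e≢f , v , j , i
    ; E-irr = λ (e≢e , _) → e≢e refl }

  Bounded : ℕ → Set
  Bounded d = ∀ v → Covered (λ e → Act e × Inc v e) d


module _ {n m : ℕ} where

  -- A path through `a`, `x`, `y`, `b` in this order. Consecutive vertices differ by looplessness,
  -- so only the other three inequalities are stored.
  record Path (G : Multi n m) (x y : Fin n) (f : Fin m) : Set where
    open Multi G
    field
      {a b} : Fin n
      {p q} : Fin m
      p∈    : Act p
      f∈    : Act f
      q∈    : Act q
      pJ    : Joins p a x
      fJ    : Joins f x y
      qJ    : Joins q y b
      a≢y   : a ≢ y
      a≢b   : a ≢ b
      x≢b   : x ≢ b

    a≢x : a ≢ x
    a≢x = joins-≢ p∈ pJ

    x≢y : x ≢ y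
    x≢y = joins-≢ f∈ fJ

    y≢b : y ≢ b
    y≢b = joins-≢ q∈ qJ

    disjoint : ∀ {v} → Inc v p → ¬ Inc v q
    disjoint i j with which-end pJ i | which-end qJ j
    ... | inj₁ v≡a | inj₁ v≡y = a≢y (trans (sym v≡a) v≡y)
    ... | inj₁ v≡a | inj₂ v≡b = a≢b (trans (sym v≡a) v≡b)
    ... | inj₂ v≡x | inj₁ v≡y = x≢y (trans (sym v≡x) v≡y)
    ... | inj₂ v≡x | inj₂ v≡b = x≢b (trans (sym v≡x) v≡b)

    p≢q : p ≢ q
    p≢q eq = disjoint (incˡ pJ) (subst (Inc a) eq (incˡ pJ))

    p≢f : p ≢ f
    p≢f eq = [ a≢x , a≢y ]′ (which-end fJ (subst (Inc a) eq (incˡ pJ)))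

    q≢f : q ≢ f
    q≢f eq = [ ≢-sym x≢b , ≢-sym y≢b ]′ (which-end fJ (subst (Inc b) eq (incʳ qJ)))

    Equal : {C : Set} → (Fin m → C) → Set
    Equal c = c p ≡ c q

  -- Reduction at a path with three edges

  module Reduction {s κ : ℕ} (2s≤k : s + s ≤ suc κ) (G : Multi n m) (bounded : Multi.Bounded G (suc s)) where
    open Multi G
    open Recolouring {m} {κ}

    nbr-cover : ∀ {g x y} → Act g → Joins g x y → Covered (λ u → Act u × E line g u) (s + s)
    nbr-cover {x = x} {y} g∈ j = covered-⊆
      (λ (u∈ , g≢u , v , ig , iu) → [ (λ { refl → inj₁ ((u∈ , iu) , ≢-sym g≢u) })
                                   , (λ { refl → inj₂ ((u∈ , iu) , ≢-sym g≢u) }) ]′ (which-end j ig))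
      (covered-⊎ (covered-delete (g∈ , incˡ j) (bounded x)) (covered-delete (g∈ , incʳ j) (bounded y)))

    -- There are at most `s + s` neighbours, so discounting a single one, already deleted or merged
    -- away, makes an edge removable.
    short : ∀ {g u} → Act g → Act u → E line g u →
      Covered (λ w → (Act w × E line g w) × w ≢ u) κ
    short g∈ u∈ e = covered-≤ (ℕₚ.pred-mono-≤ 2s≤k)
      (covered-delete (u∈ , e) (nbr-cover g∈ (proj₂ (other-end (inj₁ refl)))))

    module _ {x y f} (π : Path G x y f) where
      open Path π

      Touch : Fin m → Set
      Touch e = Inc x e ⊎ Inc y e

      Touch? : ∀ e → Dec (Touch e)
      Touch? e = Inc? x e ⊎-dec Inc? y e

      p-touch : Touch p
      p-touch = inj₁ (incʳ pJ)

      q-touch : Touch q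
      q-touch = inj₂ (incˡ qJ)

      f-touch : Touch f
      f-touch = inj₁ (incˡ fJ)

      ≢-touch : ∀ {e g} → Touch g → ¬ Touch e → e ≢ g
      ≢-touch t ¬t refl = ¬t t

      Rest : Fin m → Set
      Rest e = e ≡ p ⊎ ¬ Touch e

      Rest? : ∀ e → Dec (Rest e)
      Rest? e = (e ≟ p) ⊎-dec ¬? (Touch? e)

      ends′ : Fin m → Fin n × Fin n
      ends′ = updateAt ends p λ _ → a , b

      ends′-p : ends′ p ≡ (a , b)
      ends′-p = updateAt-updates p ends

      ends′-off : ∀ {e} → e ≢ p → ends′ e ≡ ends e
      ends′-off {e} = updateAt-minimal e p ends

      -- The multigraph without `x` and `y` but with a new edge from `a` to `b`, which reuses the
      -- index `p`.
      reduced : Multi n m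
      reduced = record
        { ends = ends′
        ; Act = λ e → Act e × Rest e
        ; Act? = λ e → Act? e ×-dec Rest? e
        ; noLoop = λ {e} (e∈ , _) → loopless e e∈ }
        where
        loopless : ∀ e → Act e → proj₁ (ends′ e) ≢ proj₂ (ends′ e)
        loopless e e∈ with e ≟ p
        ... | yes refl = subst (λ (u , v) → u ≢ v) (sym ends′-p) a≢b
        ... | no e≢p = subst (λ (u , v) → u ≢ v) (sym (ends′-off e≢p)) (noLoop e∈)

      open Multi reduced using () renaming (Inc to Inc′; Act to Act′; Joins to Joins′)

      inc′-p : ∀ {v} → Inc′ v p → v ≡ a ⊎ v ≡ b
      inc′-p {v} i = [ inj₁ ∘ sym , inj₂ ∘ sym ]′ (subst (At v) ends′-p i)

      a-inc′ : Inc′ a p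
      a-inc′ = subst (At a) (sym ends′-p) (inj₁ refl)

      b-inc′ : Inc′ b p
      b-inc′ = subst (At b) (sym ends′-p) (inj₂ refl)

      inc′⇒ : ∀ {v e} → e ≢ p → Inc′ v e → Inc v e
      inc′⇒ {v} e≢ = subst (At v) (ends′-off e≢)

      ⇒inc′ : ∀ {v e} → e ≢ p → Inc v e → Inc′ v e
      ⇒inc′ {v} e≢ = subst (At v) (sym (ends′-off e≢))

      joins′ : ∀ {e u v} → e ≢ p → Joins e u v → Joins′ e u v
      joins′ {u = u} {v} e≢ = subst (λ (s , t) → (s ≡ u × t ≡ v) ⊎ (s ≡ v × t ≡ u)) (sym (ends′-off e≢))

      toP : Fin m → Fin m
      toP = updateAt id q λ _ → p

      toP-q : toP q ≡ p
      toP-q = updateAt-updates q id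

      toP-off : ∀ {e} → e ≢ q → toP e ≡ e
      toP-off {e} = updateAt-minimal e q id

      -- The new edge takes the place of `p` at `a` and of `q` at `b`, so no degree grows.
      bounded′ : Multi.Bounded reduced (suc s)
      bounded′ v with v ≟ b
      ... | yes refl = covered-map toP source (bounded b)
        where
        source : ∀ {e} → Act′ e × Inc′ b e → ∃ λ g → (Act g × Inc b g) × toP g ≡ e
        source ((_ , inj₁ refl) , _) = q , (q∈ , incʳ qJ) , toP-q
        source ((e∈ , inj₂ ¬t) , i) = _ , (e∈ , inc′⇒ (≢-touch p-touch ¬t) i) , toP-off (≢-touch q-touch ¬t)
      ... | no v≢b = covered-⊆ back (bounded v)
        where
        back : ∀ {e} → Act′ e × Inc′ v e → Act e × Inc v e
        back ((e∈ , inj₂ ¬t) , i) = e∈ , inc′⇒ (≢-touch p-touch ¬t) i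
        back ((_ , inj₁ refl) , i) with inc′-p i
        ... | inj₁ refl = p∈ , incˡ pJ
        ... | inj₂ v≡b = ⊥-elim (v≢b v≡b)

      fewer : ∀ {N} → Covered Act (suc N) → Covered Act′ N
      fewer cov = covered-⊆ (λ { (_ , inj₁ refl) → p∈ , p≢f
                               ; (e∈ , inj₂ ¬t) → e∈ , ≢-touch f-touch ¬t }) (covered-delete f∈ cov)

      ¬Eqp : ¬ E line q p
      ¬Eqp (_ , _ , i , j) = disjoint j i

      open Merge line p∈ q∈ p≢q ¬Eqp

      -- `P` is left open because linking two pairs at one edge must retain the second pair besides
      -- `Rest`.
      remainder : (P : Fin m → Set) → (∀ u → Dec (P u)) → Graph m
      remainder P P? = restrict (merged ─ f) P P?

      touching : ∀ {e} → Touch e → e ≢ f → E line e f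
      touching (inj₁ i) e≢f = e≢f , x , i , incˡ fJ
      touching (inj₂ i) e≢f = e≢f , y , i , incʳ fJ

      -- After merging p and q the edge f sees at most κ others; once f is gone, so does every
      -- other edge at x or y.
      shrink : ∀ {P} (P? : ∀ u → Dec (P u)) → (∀ {u} → Rest u → P u) → merged ⇝ remainder P P?
      shrink {P} P? rest = ⇝-trans
        (remove merged (f∈ , ≢-sym q≢f) (covered-⊆ f-nbr (short f∈ q∈ (E-sym line (touching q-touch q≢f)))))
        (prune (merged ─ f) P? pruned)
        where
        f-nbr : ∀ {u} → V merged u × E merged f u → (Act u × E line f u) × u ≢ q
        f-nbr ((u∈ , u≢q) , inj₁ e) = (u∈ , e) , u≢q
        f-nbr (_ , inj₂ (inj₁ (f≡p , _))) = ⊥-elim (p≢f (sym f≡p))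
        f-nbr (_ , inj₂ (inj₂ (refl , _))) = (p∈ , E-sym line (touching p-touch p≢f)) , p≢q
        pruned : ∀ {v} → V (merged ─ f) v → ¬ P v → Covered (λ u → V (merged ─ f) u × E merged v u) κ
        pruned {v} ((v∈ , v≢q) , v≢f) ¬Pv = covered-map toP source (short v∈ f∈ (touching t v≢f))
          where
          t : Touch v
          t = decidable-stable (Touch? v) (¬Pv ∘ rest ∘ inj₂)
          source : ∀ {u} → V (merged ─ f) u × E merged v u →
            ∃ λ w → ((Act w × E line v w) × w ≢ f) × toP w ≡ u
          source (((u∈ , u≢q) , u≢f) , inj₁ e) = _ , ((u∈ , e) , u≢f) , toP-off u≢q
          source (_ , inj₂ (inj₁ (v≡p , _))) = ⊥-elim (¬Pv (rest (inj₁ v≡p)))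
          source (_ , inj₂ (inj₂ (refl , e))) = q , ((q∈ , E-sym line e) , q≢f) , toP-q

      -- An edge off `x` and `y` can meet `p` only at `a` and `q` only at `b`, and these are the
      -- ends of the new edge.
      E-to-p : ∀ {w} → ¬ Touch w → E merged p w → E (Multi.line reduced) p w
      E-to-p ¬t (inj₁ (p≢w , v , i , j)) with which-end pJ i
      ... | inj₁ refl = p≢w , a , a-inc′ , ⇒inc′ (≢-sym p≢w) j
      ... | inj₂ refl = ⊥-elim (¬t (inj₁ j))
      E-to-p ¬t (inj₂ (inj₁ (_ , _ , v , i , j))) with which-end qJ i
      ... | inj₁ refl = ⊥-elim (¬t (inj₂ j))
      ... | inj₂ refl = ≢-sym (≢-touch p-touch ¬t) , b , b-inc′ , ⇒inc′ (≢-touch p-touch ¬t) j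
      E-to-p ¬t (inj₂ (inj₂ (refl , _))) = ⊥-elim (¬t p-touch)

      E-to : ∀ {u w} → Rest u → Rest w → E merged u w → E (Multi.line reduced) u w
      E-to (inj₁ refl) (inj₁ refl) e = ⊥-elim (E-irr merged e)
      E-to (inj₁ refl) (inj₂ ¬t) e = E-to-p ¬t e
      E-to (inj₂ ¬t) (inj₁ refl) e = E-sym (Multi.line reduced) (E-to-p ¬t (E-sym merged e))
      E-to (inj₂ ¬t) (inj₂ ¬t′) (inj₁ (u≢w , v , i , j)) =
        u≢w , v , ⇒inc′ (≢-touch p-touch ¬t) i , ⇒inc′ (≢-touch p-touch ¬t′) j
      E-to (inj₂ ¬t) (inj₂ ¬t′) (inj₂ (inj₁ (refl , _))) = ⊥-elim (¬t p-touch)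
      E-to (inj₂ ¬t) (inj₂ ¬t′) (inj₂ (inj₂ (refl , _))) = ⊥-elim (¬t′ p-touch)

      E-from-p : ∀ {w} → ¬ Touch w → E (Multi.line reduced) p w → E merged p w
      E-from-p ¬t (p≢w , v , i , j) with inc′-p i
      ... | inj₁ refl = inj₁ (p≢w , a , incˡ pJ , inc′⇒ (≢-sym p≢w) j)
      ... | inj₂ refl = inj₂ (inj₁ (refl , ≢-sym (≢-touch q-touch ¬t) , b , incʳ qJ , inc′⇒ (≢-sym p≢w) j))

      E-from : ∀ {u w} → Rest u → Rest w → E (Multi.line reduced) u w → E merged u w
      E-from (inj₁ refl) (inj₁ refl) e = ⊥-elim (E-irr (Multi.line reduced) e)
      E-from (inj₁ refl) (inj₂ ¬t) e = E-from-p ¬t e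
      E-from (inj₂ ¬t) (inj₁ refl) e = E-sym merged (E-from-p ¬t (E-sym (Multi.line reduced) e))
      E-from (inj₂ ¬t) (inj₂ ¬t′) (u≢w , v , i , j) =
        inj₁ (u≢w , v , inc′⇒ (≢-touch p-touch ¬t) i , inc′⇒ (≢-touch p-touch ¬t′) j)

      remainder⇝ : remainder Rest Rest? ⇝ Multi.line reduced
      remainder⇝ = ⇝-iso
        (λ (((u∈ , _) , _) , r) → u∈ , r)
        (λ (u∈ , r) → ((u∈ , off r p≢q q-touch) , off r p≢f f-touch) , r)
        (λ (_ , r) (_ , r′) → E-to r r′) (λ (_ , r) (_ , r′) → E-from r r′)
        where
        off : ∀ {u g} → Rest u → p ≢ g → Touch g → u ≢ g
        off (inj₁ refl) p≢g _ = p≢g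
        off (inj₂ ¬t) _ t = ≢-touch t ¬t

      class : AllEq (Multi.line reduced) → (c d : Colouring line) →
        Equal (proj₁ c) → Equal (proj₁ d) → line ⊢ c ≈ d
      class all = merge-equal (_⇝_.allEq (⇝-trans (shrink Rest? id) remainder⇝) all)

      unmerge : ∀ {P} (P? : ∀ u → Dec (P u)) → (∀ {u} → Rest u → P u) → (c : Colouring (remainder P P?)) →
        Σ[ d ∈ Colouring line ] Equal (proj₁ d) × Agree (remainder P P?) (proj₁ d) (proj₁ c)
      unmerge P? rest c = let c₁ , agree = _⇝_.extend (shrink P? rest) c in
        split c₁ , split-equal c₁ ,
        λ u∈ → trans (split-off (proj₁ c₁) (proj₂ (proj₁ (proj₁ u∈)))) (agree u∈)

      expand : (c : Colouring (Multi.line reduced)) →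
        Σ[ d ∈ Colouring line ] Equal (proj₁ d) × (∀ {u} → Act u → ¬ Touch u → proj₁ d u ≡ proj₁ c u)
      expand c = let c₁ , agree = _⇝_.extend remainder⇝ c ; d , eq , agree′ = unmerge Rest? id c₁ in
        d , eq , λ u∈ ¬t → trans
          (agree′ (((u∈ , ≢-touch q-touch ¬t) , ≢-touch f-touch ¬t) , inj₂ ¬t)) (agree (u∈ , inj₂ ¬t))

-- Paths avoiding an edge of a simple regular graph

module Simple {n s : ℕ} (N : Fin n → Fin n → Set) (N? : ∀ x y → Dec (N x y))
              (N-sym : ∀ {x y} → N x y → N y x) (N-irr : ∀ {x} → ¬ N x x)
              (another : ∀ {x y} → N x y → (ws : List (Fin n)) → length ws ≤ s → ∃ λ w → N x w × w ∉ ws)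
              (degree≤ : ∀ x → Covered (N x) (suc s)) where

  Twin : Fin n → Fin n → Set
  Twin x y = (∀ {w} → w ≢ y → N x w → N y w) × (∀ {w} → w ≢ x → N y w → N x w)

  record FourPath (x y : Fin n) : Set where
    constructor fourPath
    field
      {v₁ v₂ v₃ v₄} : Fin n
      e₁₂ : N v₁ v₂
      e₂₃ : N v₂ v₃
      e₃₄ : N v₃ v₄
      v₁≢v₃ : v₁ ≢ v₃
      v₁≢v₄ : v₁ ≢ v₄
      v₂≢v₄ : v₂ ≢ v₄
      off₁ : v₁ ≢ x × v₁ ≢ y
      off₂ : v₂ ≢ x × v₂ ≢ y
      off₃ : v₃ ≢ x × v₃ ≢ y
      off₄ : v₄ ≢ x × v₄ ≢ y

  Site : Set
  Site = ∃ λ x → ∃ λ y → N x y × (Twin x y ⊎ FourPath x y)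

  N-≢ : ∀ {x y} → N x y → x ≢ y
  N-≢ e refl = N-irr e

  N-differ : ∀ {x a b} → N x a → ¬ N x b → a ≢ b
  N-differ e ¬e refl = ¬e e

  head-≢ : ∀ {w x : Fin n} {ws} → w ∉ x ∷ ws → w ≢ x
  head-≢ w∉ eq = w∉ (here eq)

  tail-∉ : ∀ {w x : Fin n} {ws} → w ∉ x ∷ ws → w ∉ ws
  tail-∉ w∉ w∈ = w∉ (there w∈)

  module _ {x y a} (xy : N x y) (xa : N x a) (a≢y : a ≢ y) (¬ya : ¬ N y a) where

    off-a : a ≢ x × a ≢ y
    off-a = ≢-sym (N-≢ xa) , a≢y

    a-nbr-≢y : ∀ {w} → N a w → w ≢ y
    a-nbr-≢y e refl = ¬ya (N-sym e)

    -- Besides `x`, the vertex `a` has neighbours `u`, `v`, `t`, none equal to `y`, and `u` has a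
    -- neighbour `w` outside `x`, `y`, `a`. The path `v a u w` serves unless `w` is `v`; then
    -- `t a u v` does.
    find-large : 3 ≤ s → Site
    find-large 3≤s
      with another (N-sym xa) (x ∷ []) (ℕₚ.≤-trans (s≤s z≤n) 3≤s)
    ... | u , au , u∉
      with another (N-sym xa) (x ∷ u ∷ []) (ℕₚ.≤-trans (s≤s (s≤s z≤n)) 3≤s)
    ... | v , av , v∉
      with another (N-sym xa) (x ∷ u ∷ v ∷ []) 3≤s | another (N-sym au) (x ∷ y ∷ a ∷ []) 3≤s
    ... | t , at , t∉ | w , uw , w∉ with w ≟ v
    ...   | yes refl = x , y , xy , inj₂ (fourPath (N-sym at) au uw
      (head-≢ (tail-∉ t∉)) (head-≢ (tail-∉ (tail-∉ t∉))) (N-≢ av)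
      (head-≢ t∉ , a-nbr-≢y at) off-a (head-≢ u∉ , a-nbr-≢y au) (head-≢ v∉ , a-nbr-≢y av))
    ...   | no w≢v = x , y , xy , inj₂ (fourPath (N-sym av) au uw
      (head-≢ (tail-∉ v∉)) (≢-sym w≢v) (≢-sym (head-≢ (tail-∉ (tail-∉ w∉))))
      (head-≢ v∉ , a-nbr-≢y av) off-a (head-≢ u∉ , a-nbr-≢y au) (head-≢ w∉ , head-≢ (tail-∉ w∉)))

    module _ (s≡2 : s ≡ 2) where

      next : ∀ {u w} → N u w → ∀ w₁ w₂ → ∃ λ z → N u z × z ≢ w₁ × z ≢ w₂
      next e w₁ w₂ with another e (w₁ ∷ w₂ ∷ []) (ℕₚ.≤-reflexive (sym s≡2))
      ... | z , ez , z∉ = z , ez , head-≢ z∉ , head-≢ (tail-∉ z∉)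

      -- Otherwise `w` would be a fourth neighbour of `z`, surviving three deletions from a cover of
      -- length three.
      only : ∀ {z w₁ w₂ w₃ w} → N z w₁ → N z w₂ → N z w₃ → w₁ ≢ w₂ → w₁ ≢ w₃ → w₂ ≢ w₃ →
        N z w → w ≢ w₁ → w ≢ w₂ → w ≡ w₃
      only {z} {w₃ = w₃} {w} e₁ e₂ e₃ n₁₂ n₁₃ n₂₃ e n₁ n₂ = decidable-stable (w ≟ w₃) λ n₃ →
        covered-zero ((((e , n₁) , n₂) , n₃))
          (covered-delete ((e₃ , ≢-sym n₁₃) , ≢-sym n₂₃) (covered-delete (e₂ , ≢-sym n₁₂)
            (covered-delete e₁ (subst (λ i → Covered (N z) (suc i)) s≡2 (degree≤ z)))))

      -- If u is a common neighbour of a and y, the required path avoids x y or x a, unless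
      -- u and v are twins.
      through : ∀ {u v} → N a u → N a v → u ≢ v → u ≢ x → v ≢ x → N u y → Site
      through {u} {v} au av u≢v u≢x v≢x uy
        with next (N-sym xy) x u | next uy y a
      ... | v′ , yv′ , v′≢x , v′≢u | w , uw , w≢y , w≢a with w ≟ x
      -- Now `u` has the neighbours `a`, `y`, `x`, and `x` has `y`, `a`, `u`. Neither is adjacent to
      -- `v`, so `w₃` differs from both.
      ...   | yes refl with next (N-sym av) a y
      ...     | w₃ , vw₃ , w₃≢a , w₃≢y = x , y , xy , inj₂ (fourPath (N-sym au) av vw₃
        u≢v (≢-sym w₃≢u) (≢-sym w₃≢a)
        (u≢x , a-nbr-≢y au) off-a (v≢x , a-nbr-≢y av) (w₃≢x , w₃≢y))
        where
        w₃≢x : w₃ ≢ x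
        w₃≢x refl = u≢v (sym (only xy xa (N-sym uw) (≢-sym a≢y) (N-≢ (N-sym uy)) (N-≢ au)
          (N-sym vw₃) (a-nbr-≢y av) (≢-sym (N-≢ av))))
        w₃≢u : w₃ ≢ u
        w₃≢u refl = v≢x (only (N-sym au) uy uw a≢y (≢-sym w≢a) (≢-sym w≢y)
          (N-sym vw₃) (≢-sym (N-≢ av)) (a-nbr-≢y av))
      through {u} {v} au av u≢v u≢x v≢x uy
          | v′ , yv′ , v′≢x , v′≢u | w , uw , w≢y , w≢a | no w≢x with w ≟ v′
      ...   | no w≢v′ = x , a , xa , inj₂ (fourPath (N-sym yv′) (N-sym uy) uw
        v′≢u (≢-sym w≢v′) (≢-sym w≢y)
        (v′≢x , N-differ yv′ ¬ya) (≢-sym (N-≢ xy) , ≢-sym a≢y) (u≢x , ≢-sym (N-≢ au)) (w≢x , w≢a))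
      ...   | yes refl with w ≟ v
      ...     | no w≢v = x , y , xy , inj₂ (fourPath (N-sym av) au uw
        (≢-sym u≢v) (≢-sym w≢v) (≢-sym w≢a)
        (v≢x , a-nbr-≢y av) off-a (u≢x , a-nbr-≢y au) (w≢x , w≢y))
      -- Here `u` and `v` are adjacent to each other, to `a` and to `y`, which exhausts the
      -- neighbours of both.
      ...     | yes refl = u , v , uw , inj₁
        ( (λ {z} → shared uy uw yv′ (N-sym au) (N-sym av))
        , (λ {z} → shared (N-sym yv′) (N-sym uw) (N-sym uy) (N-sym av) (N-sym au)))
        where
        shared : ∀ {g h z} → N g y → N g h → N y h → N g a → N h a → z ≢ h → N g z → N h z
        shared {z = z} gy gh yh ga ha z≢h gz with z ≟ y | z ≟ a
        ... | yes refl | _ = N-sym yh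
        ... | no _ | yes refl = ha
        ... | no z≢y | no z≢a = ⊥-elim (z≢h (only gy ga gh (≢-sym a≢y) (N-≢ yh) (N-≢ (N-sym ha)) gz z≢y z≢a))

      -- Let `u`, `v` be the other neighbours of `a`, with further neighbours `w`, `w′`. One of
      -- `v a u w` and `u a v w′` serves unless `y` occurs, which is left to `through`, or `w` and
      -- `w′` are both `x`, which would give `x` four neighbours.
      find-cubic : Site
      find-cubic with next (N-sym xa) x x
      ... | u , au , u≢x , _ with next (N-sym xa) x u
      ... | v , av , v≢x , v≢u with next (N-sym au) a v | next (N-sym av) a u
      ... | w , uw , w≢a , w≢v | w′ , vw′ , w′≢a , w′≢u with w ≟ y | w′ ≟ y | w ≟ x | w′ ≟ x
      ...   | yes refl | _ | _ | _ = through au av (≢-sym v≢u) u≢x v≢x uw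
      ...   | no _ | yes refl | _ | _ = through av au v≢u v≢x u≢x vw′
      ...   | no w≢y | no _ | no w≢x | _ = x , y , xy , inj₂ (fourPath (N-sym av) au uw
        v≢u (≢-sym w≢v) (≢-sym w≢a) (v≢x , a-nbr-≢y av) off-a (u≢x , a-nbr-≢y au) (w≢x , w≢y))
      ...   | no _ | no w′≢y | yes _ | no w′≢x = x , y , xy , inj₂ (fourPath (N-sym au) av vw′
        (≢-sym v≢u) (≢-sym w′≢u) (≢-sym w′≢a) (u≢x , a-nbr-≢y au) off-a (v≢x , a-nbr-≢y av) (w′≢x , w′≢y))
      ...   | no _ | no _ | yes refl | yes refl = ⊥-elim (v≢u
        (only xy xa (N-sym uw) (≢-sym a≢y) (≢-sym (a-nbr-≢y au)) (N-≢ au)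
          (N-sym vw′) (a-nbr-≢y av) (≢-sym (N-≢ av))))

    find-apart : 2 ≤ s → Site
    find-apart 2≤s with s ℕₚ.≟ 2
    ... | yes s≡2 = find-cubic s≡2
    ... | no s≢2 = find-large (ℕₚ.≤∧≢⇒< 2≤s (≢-sym s≢2))

  -- `another` and `degree≤` give every non-isolated vertex degree `suc s`. A neighbour of one end
  -- of the edge that is not adjacent to the other starts the search; without one the ends are
  -- twins.
  find : 2 ≤ s → ∀ {x y} → N x y → Site
  find 2≤s {x} {y} xy with any? (λ a → ¬? (a ≟ y) ×-dec (N? x a ×-dec ¬? (N? y a)))
                         | any? (λ a → ¬? (a ≟ x) ×-dec (N? y a ×-dec ¬? (N? x a)))
  ... | yes (a , a≢y , xa , ¬ya) | _ = find-apart xy xa a≢y ¬ya 2≤s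
  ... | no _ | yes (a , a≢x , ya , ¬xa) = find-apart (N-sym xy) ya a≢x ¬xa 2≤s
  ... | no none | no none′ = x , y , xy , inj₁
    ( (λ {w} w≢y xw → decidable-stable (N? y w) λ ¬yw → none (w , w≢y , xw , ¬yw))
    , (λ {w} w≢x yw → decidable-stable (N? x w) λ ¬xw → none′ (w , w≢x , yw , ¬xw)))

-- Regular line graphs

module Linking {n m t κ : ℕ} (2s≤k : suc t + suc t ≤ suc κ) (G : Multi n m)
               (bounded : Multi.Bounded G (suc (suc t)))
               (regular : ∀ {e} → Multi.Act G e → ¬ Covered (λ u → Multi.Act G u × E (Multi.line G) e u) κ) where
  open Multi G
  open Recolouring {m} {κ}
  open Reduction 2s≤k G bounded

  regular′ : ∀ {g} → Act g → ¬ Covered (λ u → Act u × E line g u) (t + suc t)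
  regular′ g∈ cov = regular g∈ (covered-≤ (ℕₚ.≤-pred 2s≤k) cov)

  -- A parallel edge is counted at both ends of `g`, which would leave `g` at most `t + suc t`
  -- neighbours.
  no-parallel : ∀ {g h x y} → Act g → Act h → Joins g x y → Joins h x y → g ≡ h
  no-parallel {g} {h} {x} {y} g∈ h∈ gJ hJ = decidable-stable (g ≟ h) λ g≢h → regular′ g∈
    (covered-⊆ ends-of-g (covered-⊎
      (covered-delete ((h∈ , incˡ hJ) , ≢-sym g≢h) (covered-delete (g∈ , incˡ gJ) (bounded x)))
      (covered-delete (g∈ , incʳ gJ) (bounded y))))
    where
    ends-of-g : ∀ {u} → Act u × E line g u →
      (((Act u × Inc x u) × u ≢ g) × u ≢ h) ⊎ ((Act u × Inc y u) × u ≢ g)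
    ends-of-g {u} (u∈ , g≢u , v , i , j) with u ≟ h | which-end gJ i
    ... | yes refl | _ = inj₂ ((u∈ , incʳ hJ) , ≢-sym g≢u)
    ... | no u≢h | inj₁ refl = inj₁ (((u∈ , j) , ≢-sym g≢u) , u≢h)
    ... | no _ | inj₂ refl = inj₂ ((u∈ , j) , ≢-sym g≢u)

  -- If `suc t` edges exhausted `x`, then `g` would have at most `t` neighbours there and `suc t` at
  -- its other end, too few for `regular′`.
  another-edge : ∀ {g x} → Act g → Inc x g → (hs : List (Fin m)) → length hs ≤ suc t →
    ∃ λ h → (Act h × Inc x h) × h ∉ hs
  another-edge {g} {x} g∈ i = escape (λ h → Act? h ×-dec Inc? x h) λ cov →
    let y , gJ = other-end i in regular′ g∈ (covered-⊆
      (λ (u∈ , g≢u , v , i , j) → [ (λ { refl → inj₁ ((u∈ , j) , ≢-sym g≢u) })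
                                  , (λ { refl → inj₂ ((u∈ , j) , ≢-sym g≢u) }) ]′ (which-end gJ i))
      (covered-⊎ (covered-delete (g∈ , i) cov) (covered-delete (g∈ , incʳ gJ) (bounded y))))

  N : Fin n → Fin n → Set
  N x y = ∃ λ h → Act h × Joins h x y

  N? : ∀ x y → Dec (N x y)
  N? x y = any? λ h → Act? h ×-dec Joins? h x y

  N-sym : ∀ {x y} → N x y → N y x
  N-sym (h , h∈ , j) = h , h∈ , Joins-sym j

  N-irr : ∀ {x} → ¬ N x x
  N-irr (_ , h∈ , j) = joins-≢ h∈ j refl

  -- Turns vertices to be avoided into edges at `x` to be avoided. For a non-neighbour the default
  -- is a harmless extra entry.
  edge-to : Fin m → Fin n → Fin n → Fin m
  edge-to default x w with N? x w
  ... | yes (h , _) = h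
  ... | no _ = default

  edge-to-≡ : ∀ {g h x w} → Act h → Joins h x w → edge-to g x w ≡ h
  edge-to-≡ {x = x} {w} h∈ hJ with N? x w
  ... | yes (_ , h′∈ , h′J) = no-parallel h′∈ h∈ h′J hJ
  ... | no ¬N = ⊥-elim (¬N (_ , h∈ , hJ))

  another : ∀ {x y} → N x y → (ws : List (Fin n)) → length ws ≤ suc t → ∃ λ w → N x w × w ∉ ws
  another {x} (g , g∈ , gJ) ws len
    with another-edge g∈ (incˡ gJ) (map (edge-to g x) ws)
           (subst (_≤ suc t) (sym (length-map (edge-to g x) ws)) len)
  ... | h , (h∈ , i) , h∉ = let w , hJ = other-end i in w , (h , h∈ , hJ) ,
    λ w∈ → h∉ (subst (_∈ map (edge-to g x) ws) (edge-to-≡ h∈ hJ) (∈-map⁺ (edge-to g x) w∈))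

  opposite : Fin n → Fin m → Fin n
  opposite x e with proj₁ (ends e) ≟ x
  ... | yes _ = proj₂ (ends e)
  ... | no _ = proj₁ (ends e)

  opposite-≡ : ∀ {x w e} → Joins e x w → opposite x e ≡ w
  opposite-≡ {x} {e = e} j with proj₁ (ends e) ≟ x
  opposite-≡ (inj₁ (_ , eq)) | yes _ = eq
  opposite-≡ (inj₂ (eq , eq′)) | yes eq″ = trans eq′ (trans (sym eq″) eq)
  opposite-≡ (inj₁ (eq , _)) | no neq = ⊥-elim (neq eq)
  opposite-≡ (inj₂ (eq , _)) | no _ = eq

  degree≤ : ∀ x → Covered (N x) (suc (suc t))
  degree≤ x = covered-map (opposite x)
    (λ (h , h∈ , j) → h , (h∈ , incˡ j) , opposite-≡ j) (bounded x)

  open Simple N N? N-sym N-irr another degree≤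

  -- Any of the excluded coincidences of vertices would make `u` and `u′` meet.
  path-at : ∀ {x y f u u′} → Act f → Joins f x y → Act u → Act u′ → u ≢ u′ → ¬ E line u u′ →
    Inc x u → Inc y u′ → Σ[ π ∈ Path G x y f ] Path.p π ≡ u × Path.q π ≡ u′
  path-at {x} {y} f∈ fJ u∈ u′∈ u≢u′ ¬e i j =
    let a , uJ = other-end i ; b , u′J = other-end j in
    record { p∈ = u∈ ; f∈ = f∈ ; q∈ = u′∈ ; pJ = Joins-sym uJ ; fJ = fJ ; qJ = u′J
           ; a≢y = λ eq → ¬e (u≢u′ , y , subst (λ v → Inc v _) eq (incʳ uJ) , j)
           ; a≢b = λ eq → ¬e (u≢u′ , b , subst (λ v → Inc v _) eq (incʳ uJ) , incʳ u′J)
           ; x≢b = λ eq → ¬e (u≢u′ , b , subst (λ v → Inc v _) eq i , incʳ u′J) } , refl , refl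

  -- f has more neighbours than there are colours other than its own.
  equal-pair : ∀ {x y f} → Act f → Joins f x y → (c : Colouring line) →
    Σ[ π ∈ Path G x y f ] Path.Equal π (proj₁ c)
  equal-pair {x} {y} {f} f∈ fJ (c , pr) =
    found (escape (λ u → Act? u ×-dec E? line f u) (regular f∈) reps
      (ℕₚ.≤-reflexive (trans (length-map _ (allFin κ)) (length-tabulate {n = κ} id))))
    where
    Nbr : Fin m → Set
    Nbr u = Act u × E line f u
    Sees : Colour → Fin m → Set
    Sees z u = Nbr u × c u ≡ z
    sees? : ∀ z → Dec (∃ (Sees z))
    sees? z = any? λ u → (Act? u ×-dec E? line f u) ×-dec (c u ≟ z)
    -- One neighbour of `f` for each colour, or `f` itself if the colour is absent around it.
    rep : Colour → Fin m
    rep z with sees? z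
    ... | yes (u , _) = u
    ... | no _ = f
    rep-sees : ∀ {z u} → Sees z u → Sees z (rep z)
    rep-sees {z} {u} s with sees? z
    ... | yes (_ , s′) = s′
    ... | no none = ⊥-elim (none (u , s))
    -- `punchIn (c f)` runs through the `κ` colours other than that of `f`. A neighbour missing from
    -- this list shares its colour with a listed one, which must lie at the other end of `f`.
    reps : List (Fin m)
    reps = map (rep ∘ punchIn (c f)) (allFin κ)
    rep∈ : ∀ {z} → c f ≢ z → rep z ∈ reps
    rep∈ cf≢z = subst (λ z → rep z ∈ reps) (punchIn-punchOut cf≢z)
      (∈-map⁺ (rep ∘ punchIn (c f)) (∈-allFin (punchOut cf≢z)))
    oriented : ∀ {u u′} → Act u → Act u′ → u ≢ u′ → c u ≡ c u′ → Inc x u → Inc y u′ →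
      Σ[ π ∈ Path G x y f ] Path.Equal π c
    oriented u∈ u′∈ u≢u′ eq i j =
      let π , eqp , eqq = path-at f∈ fJ u∈ u′∈ u≢u′ (λ e → pr u∈ u′∈ e eq) i j in
      π , trans (cong c eqp) (trans eq (sym (cong c eqq)))
    pair : ∀ {u u′} → Nbr u → Nbr u′ → u ≢ u′ → c u ≡ c u′ → Σ[ π ∈ Path G x y f ] Path.Equal π c
    pair (u∈ , _ , v , i , j) (u′∈ , _ , v′ , i′ , j′) u≢u′ eq with which-end fJ i | which-end fJ i′
    ... | inj₁ refl | inj₁ refl = ⊥-elim (pr u∈ u′∈ (u≢u′ , v , j , j′) eq)
    ... | inj₂ refl | inj₂ refl = ⊥-elim (pr u∈ u′∈ (u≢u′ , v , j , j′) eq)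
    ... | inj₁ refl | inj₂ refl = oriented u∈ u′∈ u≢u′ eq j j′
    ... | inj₂ refl | inj₁ refl = oriented u′∈ u∈ (≢-sym u≢u′) (sym eq) j′ j
    found : (∃ λ u → Nbr u × u ∉ reps) → Σ[ π ∈ Path G x y f ] Path.Equal π c
    found (u , nbr@(u∈ , e) , u∉) with rep-sees {c u} (nbr , refl)
    ... | nbr′ , eq = pair nbr nbr′ (λ u≡rep → u∉ (subst (_∈ reps) (sym u≡rep) (rep∈ (pr f∈ u∈ e)))) (sym eq)

  Common : ∀ {x y f z w g} → Path G x y f → Path G z w g → Set
  Common π σ = Σ[ c ∈ Colouring line ] Path.Equal π (proj₁ c) × Path.Equal σ (proj₁ c)

  module _ {x y f z w g} (π : Path G x y f) (σ : Path G z w g) where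
    private
      module Q = Path σ

    Avoiding : Set
    Avoiding = ¬ Touch π Q.p × ¬ Touch π g × ¬ Touch π Q.q

    persist : Avoiding → Path (reduced π) z w g
    persist (¬p , ¬g , ¬q) = record
      { p∈ = Q.p∈ , inj₂ ¬p ; f∈ = Q.f∈ , inj₂ ¬g ; q∈ = Q.q∈ , inj₂ ¬q
      ; pJ = joins′ π (≢-touch π (p-touch π) ¬p) Q.pJ
      ; fJ = joins′ π (≢-touch π (p-touch π) ¬g) Q.fJ
      ; qJ = joins′ π (≢-touch π (p-touch π) ¬q) Q.qJ
      ; a≢y = Q.a≢y ; a≢b = Q.a≢b ; x≢b = Q.x≢b }

    -- A colouring of the twice reduced multigraph is expanded first at `σ`, which equalises its
    -- outer edges, and then at `π`, which leaves the colours of edges off `x` and `y` alone.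
    common-avoiding : (av : Avoiding) →
      Colouring (Multi.line (Reduction.reduced 2s≤k (reduced π) (bounded′ π) (persist av))) → Common π σ
    common-avoiding av@(¬p , _ , ¬q) c =
      let c₁ , eq₁ , _ = Reduction.expand 2s≤k (reduced π) (bounded′ π) (persist av) c
          d , eq , agree = expand π c₁ in
      d , eq , trans (agree Q.p∈ ¬p) (trans eq₁ (sym (agree Q.q∈ ¬q)))

  -- The pairs are x a, y b and x b, y c. Once the first pair is coloured together with the edges
  -- off x and y, the second pair sees at most κ colours.
  module _ {x y f} (π ρ : Path G x y f) (b≡a : Path.b π ≡ Path.a ρ) (xc : N x (Path.b ρ)) where
    private
      module P = Path π
      module R = Path ρ
      r = proj₁ xc
      r∈ = proj₁ (proj₂ xc)
      rJ = proj₂ (proj₂ xc)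

      Second : Fin m → Set
      Second u = u ≡ R.p ⊎ u ≡ R.q

      Second? : ∀ u → Dec (Second u)
      Second? u = (u ≟ R.p) ⊎-dec (u ≟ R.q)

      Kept : Fin m → Set
      Kept u = Rest π u ⊎ Second u

      Kept? : ∀ u → Dec (Kept u)
      Kept? u = Rest? π u ⊎-dec Second? u

      open Merge line P.p∈ P.q∈ P.p≢q (¬Eqp π)

      Rp≢p : R.p ≢ P.p
      Rp≢p eq with which-end P.pJ (subst (Inc R.a) eq (incˡ R.pJ))
      ... | inj₁ a≡a = P.a≢b (trans (sym a≡a) (sym b≡a))
      ... | inj₂ a≡x = R.a≢x a≡x

      Rp≢q : R.p ≢ P.q
      Rp≢q eq = [ P.x≢y , P.x≢b ]′ (which-end P.qJ (subst (Inc x) eq (incʳ R.pJ)))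

      Rq≢p : R.q ≢ P.p
      Rq≢p eq = [ ≢-sym P.a≢y , ≢-sym P.x≢y ]′ (which-end P.pJ (subst (Inc y) eq (incˡ R.qJ)))

      Rq≢q : R.q ≢ P.q
      Rq≢q eq with which-end P.qJ (subst (Inc R.b) eq (incʳ R.qJ))
      ... | inj₁ b≡y = R.y≢b (sym b≡y)
      ... | inj₂ b≡b = R.a≢b (sym (trans b≡b b≡a))

      Rq≢r : R.q ≢ r
      Rq≢r eq = [ ≢-sym R.x≢y , R.y≢b ]′ (which-end rJ (subst (Inc y) eq (incˡ R.qJ)))

      Seen : Fin m → Set
      Seen u = u ≡ P.p ⊎
        ((((Act u × Inc R.a u) × u ≢ P.q) × u ≢ R.p) ⊎ (((Act u × Inc R.b u) × u ≢ R.q) × u ≢ r))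

      seen-cover : Covered Seen κ
      -- One entry for the merged edge and `t` at each of `R.a` and `R.b`, where two of the at most
      -- `suc (suc t)` edges touch `x` or `y`.
      seen-cover = covered-≤ (subst (_≤ κ) (ℕₚ.+-suc t t) (ℕₚ.≤-pred 2s≤k))
        (covered-⊎ (P.p ∷ [] , ℕₚ.≤-refl , here)
          (covered-⊎
            (covered-delete ((R.p∈ , incˡ R.pJ) , Rp≢q)
              (covered-delete (P.q∈ , subst (λ v → Inc v P.q) b≡a (incʳ P.qJ)) (bounded R.a)))
            (covered-delete ((r∈ , incʳ rJ) , ≢-sym Rq≢r)
              (covered-delete (R.q∈ , incʳ R.qJ) (bounded R.b)))))

      clash : ∀ {u w} → Second u → Act w → Rest π w → E merged u w → Seen w
      clash _ _ (inj₁ w≡p) _ = inj₁ w≡p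
      clash _ _ (inj₂ ¬t) (inj₂ (inj₂ (refl , _))) = ⊥-elim (¬t (p-touch π))
      clash (inj₁ refl) _ (inj₂ _) (inj₂ (inj₁ (eq , _))) = ⊥-elim (Rp≢p eq)
      clash (inj₂ refl) _ (inj₂ _) (inj₂ (inj₁ (eq , _))) = ⊥-elim (Rq≢p eq)
      clash (inj₁ refl) w∈ (inj₂ ¬t) (inj₁ (p≢w , v , i , j)) with which-end R.pJ i
      ... | inj₁ refl = inj₂ (inj₁ (((w∈ , j) , ≢-touch π (q-touch π) ¬t) , ≢-sym p≢w))
      ... | inj₂ refl = ⊥-elim (¬t (inj₁ j))
      clash (inj₂ refl) w∈ (inj₂ ¬t) (inj₁ (q≢w , v , i , j)) with which-end R.qJ i
      ... | inj₁ refl = ⊥-elim (¬t (inj₂ j))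
      ... | inj₂ refl = inj₂ (inj₂ (((w∈ , j) , ≢-sym q≢w) , ≢-touch π (inj₁ (incˡ rJ)) ¬t))

      -- The second pair is disjoint and avoids the merged vertex, so both of its edges may receive
      -- one free colour.
      ¬second : ∀ {u w} → Second u → Second w → ¬ E merged u w
      ¬second (inj₁ refl) (inj₁ refl) e = E-irr merged e
      ¬second (inj₂ refl) (inj₂ refl) e = E-irr merged e
      ¬second (inj₁ refl) (inj₂ refl) (inj₁ (_ , _ , i , j)) = R.disjoint i j
      ¬second (inj₁ refl) (inj₂ refl) (inj₂ (inj₁ (eq , _))) = Rp≢p eq
      ¬second (inj₁ refl) (inj₂ refl) (inj₂ (inj₂ (eq , _))) = Rq≢p eq
      ¬second (inj₂ refl) (inj₁ refl) (inj₁ (_ , _ , i , j)) = R.disjoint j i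
      ¬second (inj₂ refl) (inj₁ refl) (inj₂ (inj₁ (eq , _))) = Rq≢p eq
      ¬second (inj₂ refl) (inj₁ refl) (inj₂ (inj₂ (eq , _))) = Rp≢p eq

    common-at-twin : Colouring (Multi.line (reduced π)) → Common π ρ
    common-at-twin (c , pr) =
      let d , eq , agree = unmerge π Kept? inj₁ (paint , proper) in
      d , eq , trans (agree (((R.p∈ , Rp≢q) , R.p≢f) , inj₂ (inj₁ refl)))
                (trans (trans (paint-second (inj₁ refl)) (sym (paint-second (inj₂ refl))))
                       (sym (agree (((R.q∈ , Rq≢q) , R.q≢f) , inj₂ (inj₂ refl)))))
      where
      z = proj₁ (free-colour c seen-cover)
      z-free : ∀ {u} → Seen u → c u ≢ z
      z-free = proj₂ (free-colour c seen-cover)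
      paint : Fin m → Colour
      paint u with Second? u
      ... | yes _ = z
      ... | no _ = c u
      paint-second : ∀ {u} → Second u → paint u ≡ z
      paint-second {u} s with Second? u
      ... | yes _ = refl
      ... | no ¬s = ⊥-elim (¬s s)
      kept-rest : ∀ {u} → Kept u → ¬ Second u → Rest π u
      kept-rest (inj₁ r) _ = r
      kept-rest (inj₂ s) ¬s = ⊥-elim (¬s s)
      proper : Proper (remainder π Kept Kept?) paint
      proper {u} {w} (((u∈ , _) , _) , ku) (((w∈ , _) , _) , kw) e with Second? u | Second? w
      ... | yes s | yes s′ = ⊥-elim (¬second s s′ e)
      ... | yes s | no ¬s = ≢-sym (z-free (clash s w∈ (kept-rest kw ¬s) e))
      ... | no ¬s | yes s = z-free (clash s u∈ (kept-rest ku ¬s) (E-sym merged e))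
      ... | no ¬s | no ¬s′ = let ru = kept-rest ku ¬s ; rw = kept-rest kw ¬s′ in
        pr (u∈ , ru) (w∈ , rw) (E-to π ru rw e)

  module _ (2≤s : 2 ≤ suc t)
           (ih : (G′ : Multi n m) → Multi.Bounded G′ (suc (suc t)) →
             (∀ {i} → Covered Act (suc i) → Covered (Multi.Act G′) i) →
             Colouring (Multi.line G′) × AllEq (Multi.line G′)) where

    ih-at : ∀ {x y f} (π : Path G x y f) → Colouring (Multi.line (reduced π)) × AllEq (Multi.line (reduced π))
    ih-at π = ih (reduced π) (bounded′ π) (fewer π)

    via : ∀ {x y f} (π : Path G x y f) (c d : Colouring line) →
      Path.Equal π (proj₁ c) → Path.Equal π (proj₁ d) → line ⊢ c ≈ d
    via π = class π (proj₂ (ih-at π))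

    -- Any path with middle edge `f` will do; `2 ≤ suc t` gives the end of `q` a choice other than
    -- the two vertices before `y`.
    colourable : ∀ {f} → Act f → Colouring line
    colourable {f} f∈ =
      let y , fJ = other-end {f} (inj₁ refl)
          a , (p , p∈ , pJ) , a∉ = another (f , f∈ , fJ) (y ∷ []) (s≤s z≤n)
          b , (q , q∈ , qJ) , b∉ = another (N-sym (f , f∈ , fJ)) (_ ∷ a ∷ []) 2≤s
          π = record { p∈ = p∈ ; f∈ = f∈ ; q∈ = q∈ ; pJ = Joins-sym pJ ; fJ = fJ ; qJ = qJ
                     ; a≢y = head-≢ a∉ ; a≢b = ≢-sym (head-≢ (tail-∉ b∉)) ; x≢b = ≢-sym (head-≢ b∉) }
      in proj₁ (expand π (proj₁ (ih-at π)))

    module _ {x y f} (f∈ : Act f) (fJ : Joins f x y) where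

      -- The class of the path away from `x` and `y` is a hub: it has a member in common with each
      -- class at `f`, hence with those of `c` and `d`.
      at-path : FourPath x y → AllEq line
      at-path (fourPath (p , p∈ , pJ) (g , g∈ , gJ) (q , q∈ , qJ) n₁₃ n₁₄ n₂₄ o₁ o₂ o₃ o₄) c d =
        let π , ceq = equal-pair f∈ fJ c ; ρ , deq = equal-pair f∈ fJ d
            c₁ , eq₁ , eq₁′ = common π ; d₁ , eq₂ , eq₂′ = common ρ in
        via π c c₁ ceq eq₁ ◅◅ via σ c₁ d₁ eq₁′ eq₂′ ◅◅ via ρ d₁ d eq₂ deq
        where
        σ : Path G _ _ g
        σ = record { p∈ = p∈ ; f∈ = g∈ ; q∈ = q∈ ; pJ = pJ ; fJ = gJ ; qJ = qJ
                   ; a≢y = n₁₃ ; a≢b = n₁₄ ; x≢b = n₂₄ }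
        off : ∀ {e u v} → Joins e u v → u ≢ x × u ≢ y → v ≢ x × v ≢ y → ¬ (Inc x e ⊎ Inc y e)
        off j (u≢x , _) (v≢x , _) (inj₁ i) = [ ≢-sym u≢x , ≢-sym v≢x ]′ (which-end j i)
        off j (_ , u≢y) (_ , v≢y) (inj₂ i) = [ ≢-sym u≢y , ≢-sym v≢y ]′ (which-end j i)
        common : (π : Path G x y f) → Common π σ
        common π = common-avoiding π σ av (proj₁ (ih (R.reduced σ′) (R.bounded′ σ′) λ cov →
          covered-⊆ proj₁ (fewer π cov)))
          where
          av : Avoiding π σ
          av = off pJ o₁ o₂ , off gJ o₂ o₃ , off qJ o₃ o₄
          σ′ = persist π σ av
          module R = Reduction 2s≤k (reduced π) (bounded′ π)

      at-twin : Twin x y → AllEq line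
      at-twin (to-y , to-x) c d = joined (Path.b π ≟ Path.a ρ)
        where
        π = proj₁ (equal-pair f∈ fJ c)
        ρ = proj₁ (equal-pair f∈ fJ d)
        ceq = proj₂ (equal-pair f∈ fJ c)
        deq = proj₂ (equal-pair f∈ fJ d)
        end : (τ : Path G x y f) → N x (Path.b τ)
        end τ = to-x (≢-sym (Path.x≢b τ)) (_ , Path.q∈ τ , Path.qJ τ)
        start : (τ : Path G x y f) → N y (Path.a τ)
        start τ = to-y (Path.a≢y τ) (_ , Path.p∈ τ , Joins-sym (Path.pJ τ))
        common : (τ υ : Path G x y f) → Path.b τ ≡ Path.a υ → Common τ υ
        common τ υ eq = common-at-twin τ υ eq (end υ) (proj₁ (ih-at τ))
        joined : Dec (Path.b π ≡ Path.a ρ) → line ⊢ c ≈ d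
        joined (yes eq) = let e , eq₁ , eq₂ = common π ρ eq in via π c e ceq eq₁ ◅◅ via ρ e d eq₂ deq
        joined (no neq) =
          let e , eq₁ , eq₂ = common π μ refl ; e′ , eq₃ , eq₄ = common μ ρ refl in
          via π c e ceq eq₁ ◅◅ via μ e e′ eq₂ eq₃ ◅◅ via ρ e′ d eq₄ deq
          where
          -- An intermediate path from `Path.b π` through `x`, `y` to `Path.a ρ`, available because
          -- `x` and `y` are twins; it links to `π` and to `ρ`.
          μ : Path G x y f
          μ = record
            { p∈ = proj₁ (proj₂ (end π)) ; f∈ = f∈ ; q∈ = proj₁ (proj₂ (start ρ))
            ; pJ = Joins-sym (proj₂ (proj₂ (end π))) ; fJ = fJ ; qJ = proj₂ (proj₂ (start ρ))
            ; a≢y = ≢-sym (Path.y≢b π) ; a≢b = neq ; x≢b = ≢-sym (Path.a≢x ρ) }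

    all-equivalent : ∀ {f} → Act f → AllEq line
    all-equivalent {f} f∈ with find 2≤s (f , f∈ , proj₂ (other-end (inj₁ refl)))
    ... | x , y , (g , g∈ , gJ) , inj₁ twin = at-twin g∈ gJ twin
    ... | x , y , (g , g∈ , gJ) , inj₂ path = at-path g∈ gJ path

-- Induction on the number of edges

module Induction {n m s κ : ℕ} (2s≤k : s + s ≤ suc κ) where
  open Recolouring {m} {κ}

  delete-edge : Multi n m → Fin m → Multi n m
  delete-edge G g = record
    { ends = ends ; Act = λ e → Act e × e ≢ g ; Act? = λ e → Act? e ×-dec ¬? (e ≟ g)
    ; noLoop = noLoop ∘ proj₁ }
    where open Multi G

  -- Colourability is proved alongside because the common members of classes come from colourings of
  -- smaller multigraphs. The alternatives are a spare colour, which makes every edge removable, or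
  -- degree bound at least three.
  colourable×equivalent : s + s ≤ κ ⊎ 2 ≤ s → ∀ {i} (G : Multi n m) → Multi.Bounded G (suc s) → Covered (Multi.Act G) i →
    Colouring (Multi.line G) × AllEq (Multi.line G)
  colourable×equivalent slack {i} G bounded cover with any? (Multi.Act? G)
  ... | no none = ((λ _ → zero) , λ u∈ → ⊥-elim (none (_ , u∈))) ,
    λ c d → agree-≈ (Multi.line G) c d λ u∈ → ⊥-elim (none (_ , u∈))
  colourable×equivalent slack {zero} G bounded cover | yes (_ , g∈) = ⊥-elim (covered-zero g∈ cover)
  colourable×equivalent slack {suc i} G bounded cover | yes (g , g∈)
    with any? (λ e → Multi.Act? G e ×-dec
           covered? (λ u → Multi.Act? G u ×-dec E? (Multi.line G) e u) κ)
  ... | yes (e , e∈ , short) =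
    let c , all = colourable×equivalent slack {i} (delete-edge G e)
                    (λ v → covered-⊆ (λ ((u∈ , _) , j) → u∈ , j) (bounded v)) (covered-delete e∈ cover)
        r = remove (Multi.line G) e∈ short in
    proj₁ (_⇝_.extend r c) , _⇝_.allEq r all
  ... | no regular with slack
  ...   | inj₁ 2s≤κ = ⊥-elim (regular (g , g∈ ,
    covered-≤ 2s≤κ (Reduction.nbr-cover 2s≤k G bounded g∈ (proj₂ (Multi.other-end G (inj₁ refl))))))
  -- Matching on `s≤s` exposes `s` as a successor, the form that `Linking` takes.
  ...   | inj₂ 2≤s@(s≤s _) = L.colourable 2≤s ih g∈ , L.all-equivalent 2≤s ih g∈
    where
    rich : ∀ {e} → Multi.Act G e → ¬ Covered (λ u → Multi.Act G u × E (Multi.line G) e u) κ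
    rich e∈ short = regular (_ , e∈ , short)
    module L = Linking 2s≤k G bounded rich
    ih : (G′ : Multi n m) → Multi.Bounded G′ (suc s) →
      (∀ {i} → Covered (Multi.Act G) (suc i) → Covered (Multi.Act G′) i) →
      Colouring (Multi.line G′) × AllEq (Multi.line G′)
    ih G′ bounded′ fewer = colourable×equivalent (inj₂ 2≤s) {i} G′ bounded′ (fewer cover)

-- Kempe changes and degrees of the given multigraph

module Kempe (G : Multigraph) {κ : ℕ} where
  open Multigraph G
  open Recolouring {m} {κ}

  multi : Multi n m
  multi = record { ends = ends ; Act = λ _ → ⊤ ; Act? = λ _ → yes tt ; noLoop = λ {e} _ → loopless e }

  open Multi multi using (line; Inc?)

  fromEdgeColouring : EdgeColouring G (suc κ) → Colouring line
  fromEdgeColouring (c , pr) = c , λ _ _ (e≢f , share) → pr _ _ e≢f share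

  share? : ∀ e f → Dec (ShareEnd G e f)
  share? e f = any? λ v → Inc? v e ×-dec Inc? v f

  module _ (c : Fin m → Colour) (x y : Colour) where

    Component : Fin m → Set
    Component e = Σ[ es ∈ List (Fin m) ]
      (∀ {f} → f ∈ es → Reach G c x y e f) × (∀ {f} → Reach G c x y e f → f ∈ es)

    -- The component is grown edge by edge until it is closed; `i` bounds the edges still outside
    -- the list. This makes membership in it decidable.
    component : ∀ {e} → InAB G c x y e → Component e
    component {e} e∈xy = grow m (e ∷ []) (here refl) (λ { (here refl) → here e∈xy })
      covered-all
      where
      grow : ∀ i (es : List (Fin m)) → e ∈ es → (∀ {f} → f ∈ es → Reach G c x y e f) →
        Covered (_∉ es) i → Component e
      grow i es e∈ sound cover
        with any? (λ f → any? λ g → _∈?_ _≟_ f es ×-dec (share? f g ×-dec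
               (((c g ≟ x) ⊎-dec (c g ≟ y)) ×-dec ¬? (_∈?_ _≟_ g es))))
      ... | no closed = es , sound , complete
        where
        complete : ∀ {f} → Reach G c x y e f → f ∈ es
        complete (here _) = e∈
        complete (step {f} {g} r sh g∈xy) = decidable-stable (_∈?_ _≟_ g es) λ g∉ →
          closed (f , g , complete r , sh , g∈xy , g∉)
      grow zero es e∈ sound cover | yes (f , g , f∈ , sh , g∈xy , g∉) = ⊥-elim (covered-zero g∉ cover)
      grow (suc i) es e∈ sound cover | yes (f , g , f∈ , sh , g∈xy , g∉) = grow i (g ∷ es) (there e∈)
        (λ { (here refl) → step (sound f∈) sh g∈xy ; (there h∈) → sound h∈ })
        (covered-⊆ (λ h∉ → h∉ ∘ there , λ h≡g → h∉ (here h≡g)) (covered-delete g∉ cover))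

  flip-swap : ∀ {a b u v} → Flip a b u v → v ≢ u → v ≡ swap G a b u
  flip-swap (keep eq) v≢u = ⊥-elim (v≢u eq)
  flip-swap {a} {b} {u} (fwd u≡a v≡b) _ with u ≟ a
  ... | yes _ = v≡b
  ... | no u≢a = ⊥-elim (u≢a u≡a)
  flip-swap {a} {b} {u} (bwd u≡b v≡a) v≢u with u ≟ a
  ... | yes u≡a = ⊥-elim (v≢u (trans v≡a (sym u≡a)))
  ... | no _ with u ≟ b
  ...   | yes _ = v≡a
  ...   | no u≢b = ⊥-elim (u≢b u≡b)

  flip-InAB : ∀ {a b} (c : Fin m → Colour) {e v} → Flip a b (c e) v → v ≢ c e → InAB G c a b e
  flip-InAB _ (keep eq) v≢ = ⊥-elim (v≢ eq)
  flip-InAB _ (fwd eq _) _ = inj₁ eq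
  flip-InAB _ (bwd eq _) _ = inj₂ eq

  module _ {a b : Colour} {d : Fin m → Colour} (d-proper : Proper line d) where

    Flips : (Fin m → Colour) → Set
    Flips c = ∀ e → Flip a b (c e) (d e)

    -- A changed edge takes the other of the two colours. An adjacent edge coloured `a` or `b` that
    -- stayed unchanged would clash with it before or after the change.
    component-differs : ((c , _) : Colouring line) → Flips c → ∀ {e f} → d e ≢ c e →
      Reach G c a b e f → d f ≢ c f
    component-differs _ fl de≢ (here _) = de≢
    component-differs (c , pr) fl de≢ (step {f} {g} r sh g∈ab) dg≡cg with f ≟ g
    ... | yes refl = component-differs (c , pr) fl de≢ r dg≡cg
    ... | no f≢g with fl f | g∈ab
    ...   | keep df≡cf | _ = component-differs (c , pr) fl de≢ r df≡cf
    ...   | fwd cf≡a _ | inj₁ cg≡a = pr tt tt (f≢g , sh) (trans cf≡a (sym cg≡a))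
    ...   | fwd _ df≡b | inj₂ cg≡b = d-proper tt tt (f≢g , sh) (trans df≡b (trans (sym cg≡b) (sym dg≡cg)))
    ...   | bwd _ df≡a | inj₁ cg≡a = d-proper tt tt (f≢g , sh) (trans df≡a (trans (sym cg≡a) (sym dg≡cg)))
    ...   | bwd cf≡b _ | inj₂ cg≡b = pr tt tt (f≢g , sh) (trans cf≡b (sym cg≡b))

    -- One component containing a changed edge is interchanged at a time, and `i` bounds the edges
    -- still to be changed.
    flips⇒kempe : ∀ i ((c , _) : Colouring line) → Flips c → Covered (λ e → d e ≢ c e) i →
      ∃ λ c₁ → Star (KempeChange G) c c₁ × (∀ e → c₁ e ≡ d e)
    flips⇒kempe i (c , pr) fl cover with any? (λ e → ¬? (d e ≟ c e))
    ... | no none = c , ε , λ e → sym (decidable-stable (d e ≟ c e) λ de≢ → none (e , de≢))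
    flips⇒kempe zero (c , pr) fl cover | yes (e , de≢) = ⊥-elim (covered-zero de≢ cover)
    flips⇒kempe (suc i) (c , pr) fl cover | yes (e , de≢) =
      let c₁ , path , c₁≡d = flips⇒kempe i (c′ , proper) flips differing in c₁ , change ◅ path , c₁≡d
      where
      e∈ab : InAB G c a b e
      e∈ab = flip-InAB c (fl e) de≢
      comp = component c a b e∈ab
      es = proj₁ comp
      sound = proj₁ (proj₂ comp)
      complete = proj₂ (proj₂ comp)
      c′ : Fin m → Colour
      c′ f with _∈?_ _≟_ f es
      ... | yes _ = d f
      ... | no _ = c f
      c′-in : ∀ {f} → f ∈ es → c′ f ≡ d f
      c′-in {f} f∈ with _∈?_ _≟_ f es
      ... | yes _ = refl
      ... | no f∉ = ⊥-elim (f∉ f∈)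
      c′-out : ∀ {f} → f ∉ es → c′ f ≡ c f
      c′-out {f} f∉ with _∈?_ _≟_ f es
      ... | yes f∈ = ⊥-elim (f∉ f∈)
      ... | no _ = refl
      change : KempeChange G c c′
      change = a , b , e , e∈ab , λ f →
        (λ r → trans (c′-in (complete r)) (flip-swap (fl f) (component-differs (c , pr) fl de≢ r))) ,
        (λ ¬r → c′-out (¬r ∘ sound))
      -- An edge `g` outside the component but adjacent to it is unchanged, as it would otherwise be
      -- reachable; so a clash would already occur in `d`.
      boundary : ∀ {f g} → f ∈ es → g ∉ es → E line f g → d f ≢ c g
      boundary {f} {g} f∈ g∉ (f≢g , sh) df≡cg = d-proper tt tt (f≢g , sh)
        (trans df≡cg (sym (decidable-stable (d g ≟ c g) λ dg≢ →
          g∉ (complete (step (sound f∈) sh (flip-InAB c (fl g) dg≢))))))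
      proper : Proper line c′
      proper {f} {g} _ _ e with _∈?_ _≟_ f es | _∈?_ _≟_ g es
      ... | yes _ | yes _ = d-proper tt tt e
      ... | yes f∈ | no g∉ = boundary f∈ g∉ e
      ... | no f∉ | yes g∈ = ≢-sym (boundary g∈ f∉ (E-sym line e))
      ... | no _ | no _ = pr tt tt e
      flips : Flips c′
      flips f with _∈?_ _≟_ f es
      ... | yes _ = keep refl
      ... | no _ = fl f
      differing : Covered (λ f → d f ≢ c′ f) i
      differing = covered-⊆ (λ {f} df≢ →
          let f∉ = λ f∈ → df≢ (sym (c′-in f∈)) in
          (λ df≡cf → df≢ (trans df≡cf (sym (c′-out f∉)))) , (λ { refl → f∉ (complete (here e∈ab)) }))
        (covered-delete de≢ cover)

  -- Kempe changes reach the next colouring only pointwise, so the start `c₀` is allowed to be a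
  -- pointwise copy of `c`.
  ≈⇒kempe : ∀ {c d} → line ⊢ c ≈ d → ∀ c₀ → (∀ e → c₀ e ≡ proj₁ c e) →
    ∃ λ c₁ → Star (KempeChange G) c₀ c₁ × (∀ e → c₁ e ≡ proj₁ d e)
  ≈⇒kempe ε c₀ eq = c₀ , ε , eq
  ≈⇒kempe {c} (_◅_ {j = c₂} (a , b , fl) path) c₀ eq =
    let c₁ , changes , eq₁ = flips⇒kempe {a} {b} (proj₂ c₂) m (c₀ , c₀-proper)
          (λ e → subst (λ x → Flip a b x (proj₁ c₂ e)) (sym (eq e)) (fl tt))
          covered-all
        d₁ , changes′ , eq₂ = ≈⇒kempe path c₁ eq₁ in
    d₁ , changes ◅◅ changes′ , eq₂
    where
    c₀-proper : Proper line c₀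
    c₀-proper _ _ e eq′ = proj₂ c tt tt e (trans (sym (eq _)) (trans eq′ (eq _)))

  -- The summand of `degree` is built from a private function; `refl` lets unification recover it.
  endCount : ∀ v → Σ[ F ∈ (Fin m → ℕ) ] degree G v ≡ sum (map F (allFin m))
  endCount v = _ , refl

  endCount-positive : ∀ v {e} → Incident G v e → 1 ≤ proj₁ (endCount v) e
  endCount-positive v {e} i with proj₁ (ends e) ≟ v | proj₂ (ends e) ≟ v
  ... | yes _ | _ = s≤s z≤n
  ... | no _ | yes _ = s≤s z≤n
  endCount-positive v (inj₁ eq) | no neq | no _ = ⊥-elim (neq eq)
  endCount-positive v (inj₂ eq) | no _ | no neq = ⊥-elim (neq eq)

  incident-cover : ∀ v → Covered (Incident G v) (degree G v)
  incident-cover v = filter (Inc? v) (allFin m) ,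
    length-filter≤sum (Inc? v) (proj₁ (endCount v)) (endCount-positive v) (allFin m) ,
    λ {e} i → ∈-filter⁺ (Inc? v) (∈-allFin e) i

  degree≤maxDegree : ∀ v → degree G v ≤ maxDegree G
  degree≤maxDegree v = below (allFin n) (∈-allFin v)
    where
    below : ∀ vs → v ∈ vs → degree G v ≤ foldr _⊔_ 0 (map (degree G) vs)
    below (_ ∷ vs) (here refl) = ℕₚ.m≤m⊔n _ _
    below (_ ∷ vs) (there v∈) = ℕₚ.≤-trans (below vs v∈) (ℕₚ.m≤n⊔m _ _)

  all-kempe-equivalent : ∀ {s} → s + s ≤ suc κ → s + s ≤ κ ⊎ 2 ≤ s → maxDegree G ≤ suc s →
    AllKempeEquivalent G (suc κ)
  all-kempe-equivalent 2s≤k slack Δ≤ c d =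
    let _ , all = Induction.colourable×equivalent 2s≤k slack {m} multi
          (λ v → covered-⊆ proj₂ (covered-≤ (ℕₚ.≤-trans (degree≤maxDegree v) Δ≤) (incident-cover v)))
          covered-all
        c₁ , changes , eq = ≈⇒kempe (all (fromEdgeColouring c) (fromEdgeColouring d)) (proj₁ c) (λ _ → refl) in
    c₁ , changes , idPermutation , λ e → sym (eq e)

theorem11 : (G : Multigraph) →
    (maxDegree G ≤ 3 → AllKempeEquivalent G (suc (maxDegree G)))
    × (maxDegree G ≡ 4 → AllKempeEquivalent G 6)
theorem11 G = (λ Δ≤3 → small (maxDegree G) ℕₚ.≤-refl Δ≤3) ,
  -- Degree at most `suc 3` and `6 = 3 + 3` colours: the tight case.
  λ Δ≡4 → all-kempe-equivalent {s = 3} (toWitness {a? = 6 ≤? 6} _) (inj₂ (s≤s (s≤s z≤n))) (ℕₚ.≤-reflexive Δ≡4)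
  where
  open Kempe G
  small : ∀ Δ → maxDegree G ≤ Δ → Δ ≤ 3 → AllKempeEquivalent G (suc Δ)
  -- For `Δ` up to 2 there is a spare colour beyond `s + s`; for `Δ = 3` the four colours equal
  -- `s + s` with `s = 2`.
  small 0 Δ≤ _ = all-kempe-equivalent {s = 0} z≤n (inj₁ z≤n) (ℕₚ.≤-trans Δ≤ z≤n)
  small 1 Δ≤ _ = all-kempe-equivalent {s = 0} z≤n (inj₁ z≤n) Δ≤
  small 2 Δ≤ _ = all-kempe-equivalent {s = 1} (toWitness {a? = 2 ≤? 3} _) (inj₁ ℕₚ.≤-refl) Δ≤
  small 3 Δ≤ _ = all-kempe-equivalent {s = 2} ℕₚ.≤-refl (inj₂ ℕₚ.≤-refl) Δ≤
  small (suc (suc (suc (suc _)))) _ (s≤s (s≤s (s≤s ())))
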